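{- Let $p$ be a prime and let $A$ be a multiplicative subgroup of $\mathbb{F}_p^*$ with $|A|\le p^{1/2}\log p$. Then \[|[A,A,0][A,A,0]|\gtrsim |[A,A,0]|^{151/80}.\]
   Context: The Heisenberg group $H_1(\mathbb{F}_p)$ consists of the matrices $[x,y,z]=\begin{bmatrix}1&x&z\\0&1&y\\0&0&1\end{bmatrix}$, $x,y,z\in\mathbb{F}_p$, with matrix multiplication, so $[x,y,z][x',y',z']=[x+x',y+y',z+z'+xy']$. $[A,A,0]=\{[x,y,0]:x,y\in A\}$ and $[A,A,0][A,A,0]=\{mm':m,m'\in[A,A,0]\}$. Notation: $X\ll Y$ means $X\le CY$ for an absolute constant $C>0$; $X\lesssim Y$ means $X\ll (\log Y)^{C'}Y$ for some absolute constant $C'>0$; and $X\gtrsim Y$ means $Y\lesssim X$.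
   Formalization: The logarithmic factor log X implicit in ≳ is read as 1 + ⌊log₂ X⌋, which agrees with log X up to absolute constant factors for X ≥ 2; with log 1 = 0 the literal bound would fail for the trivial subgroup A = {1}, where both sets have one element. -}

module Defs where

open import Data.Nat using (ℕ; zero; suc; _+_; _*_; _∸_; _^_; _≤_; _<_; _%_)
open import Data.Nat.Properties using (_≟_)
open import Data.Nat.Logarithm using (⌊log₂_⌋)
open import Data.Product using (_×_; _,_; Σ-syntax)
open import Data.Product.Properties using (≡-dec)
open import Data.List using (List; []; _∷_; length; map; cartesianProduct; cartesianProductWith; deduplicate; upTo)
open import Data.Nat.ListAction using (sum)
open import Data.List.Membership.Propositional using (_∈_)
open import Data.List.Relation.Unary.All using (All)
open import Data.List.Relation.Unary.Unique.Propositional using (Unique)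
open import Relation.Binary.PropositionalEquality using (_≡_)
open import Relation.Binary.Definitions using (DecidableEquality)

-- The prime field F_p, represented by the naturals 0 , … , p - 1,
-- with arithmetic reduced mod p.

-- reduction mod p (p is prime in the theorem, so the zero case is unused)
_modℕ_ : ℕ → ℕ → ℕ
m modℕ zero    = m
m modℕ (suc n) = m % suc n

record IsMultSubgroup (p : ℕ) (A : List ℕ) : Set where
  field
    unique   : Unique A
    inFpStar : All (λ a → 1 ≤ a × a < p) A
    hasOne   : 1 ∈ A
    mulClosed : ∀ {a b} → a ∈ A → b ∈ A → (a * b) modℕ p ∈ A
    invClosed : ∀ {a} → a ∈ A → Σ[ b ∈ ℕ ] (b ∈ A × (a * b) modℕ p ≡ 1)

card : List ℕ → ℕ
card = length

-- The Heisenberg group H_1(F_p): [x,y,z] is the triple (x , y , z).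

Heis : Set
Heis = ℕ × ℕ × ℕ

hmul : ℕ → Heis → Heis → Heis
hmul p (x , y , z) (x' , y' , z') =
  ((x + x') modℕ p , (y + y') modℕ p , (z + z' + x * y') modℕ p)

Heis-≟ : DecidableEquality Heis
Heis-≟ = ≡-dec _≟_ (≡-dec _≟_ _≟_)

-- finite subsets of H_1(F_p) are duplicate-free lists
dedup : List Heis → List Heis
dedup = deduplicate Heis-≟

AA0 : List ℕ → List Heis
AA0 A = dedup (cartesianProductWith (λ x y → (x , y , 0)) A A)

prodSet : ℕ → List Heis → List Heis → List Heis
prodSet p S S' = dedup (cartesianProductWith (hmul p) S S')

cardH : List Heis → ℕ
cardH = length

-- The hypothesis |A| ≤ p^{1/2} log p  (natural logarithm), stated without
-- real numbers.  With y = |A| / √p it says y ≤ ln p, i.e. every rational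
-- r = n/d with 0 ≤ r < y satisfies exp r ≤ p, i.e. every partial sum
-- Σ_{k ≤ N} r^k / k! is ≤ p.  Multiplying through by d^N · N! gives the
-- natural-number inequality below; r < y is n² p < |A|² d².

fallingFrom : ℕ → ℕ → ℕ
fallingFrom N k = go (N ∸ k) N
  where
  go : ℕ → ℕ → ℕ
  go zero    _ = 1
  go (suc j) m = m * go j (m ∸ 1)

-- d^N · N! · Σ_{k ≤ N} (n/d)^k / k!
expPartialScaled : ℕ → ℕ → ℕ → ℕ
expPartialScaled n d N =
  sum (map (λ k → n ^ k * d ^ (N ∸ k) * fallingFrom N k) (upTo (suc N)))

LeSqrtTimesLn : ℕ → ℕ → Set
LeSqrtTimesLn a p =
  ∀ (n d N : ℕ) → 1 ≤ d → n * n * p < a * a * (d * d) →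
  expPartialScaled n d N ≤ p * (d ^ N * fallingFrom N 0)

-- log factor used for ≳ : a logarithm that is ≥ 1, comparable to ln X
-- up to absolute constant factors for X ≥ 2.
logF : ℕ → ℕ
logF X = suc ⌊log₂ X ⌋

module Submission where

-- Write h = |A| and let E be the number of coincidences (x + x', y + y', x y') = (X + X', Y + Y', X Y').
-- Putting u = X / x = y' / Y', the first two coordinates read (u - 1) x = x' - X' and (u - 1) Y' = Y - y, so
-- that E ≤ h² ∑_{u ∈ A} T(u)², where T(1) = h and, for u ≠ 1, T(u) is the number of t ∈ A \ {1} with
-- (t - 1)^h = (u - 1)^h. The values (t - 1)^h split A \ {1} into classes, and Stepanov's method bounds their
-- sizes: with q ≈ h^(1/15), every class has O(q^10) elements and fewer than q^3 classes have more than O(q^9).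
-- Hence ∑ T(u)² = O(q^33) = O(q^3 h^2), E = O(q^3 h^4), and Cauchy–Schwarz gives a product set of size at
-- least a constant times h^4 / q^3, about |[A,A,0]|^(19/10), which beats the exponent 151/80.
-- The hypothesis |A| ≤ √p log p is used only to get h^(7/5) = O(p).
--
-- Stepanov's method: the polynomials ∑ X^{hc} (X - 1)^{hb} P_{bc} with b, c < β and deg P_{bc} < α have α β²
-- coefficients, while vanishing to order α at all u ∈ A of n classes costs at most 2 n α² linear conditions,
-- because X^h = 1 and (X - 1)^h is constant on a class. If α β ≤ h, a solution is a nonzero polynomial, of
-- degree below 2 h β, so that the n classes have fewer than 2 h β / α elements.

open import Algebra.Bundles using (CommutativeRing)
open import Data.Empty using (⊥-elim)
open import Data.Fin as Fin using (Fin; toℕ; fromℕ<; combine; remQuot; funToFin; finToFun)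
import Data.Fin.Properties as Finₚ
open import Data.List using (List; []; _∷_; _++_; length; map; upTo; tabulate)
open import Data.List.Membership.Propositional using (_∈_)
open import Data.List.Membership.Propositional.Properties
open import Data.List.Properties using (length-++; length-++-sucʳ; length-map; length-upTo; length-tabulate; length-take; length-filter; length-deduplicate; filter-++)
open import Data.List.Relation.Binary.Pointwise using (Pointwise; []; _∷_; tabulate⁻)
open import Data.List.Relation.Unary.All as All using (All; []; _∷_)
import Data.List.Relation.Unary.All.Properties as Allₚ
open import Data.List.Relation.Unary.AllPairs using (AllPairs; []; _∷_)
open import Data.List.Relation.Unary.Any as Any using (here; there)
open import Data.List.Relation.Unary.Unique.Propositional using (Unique)
open import Data.Nat as ℕ using (ℕ; zero; suc; z≤n; s≤s; _%_; NonZero)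
open import Data.Nat.DivMod using (m%n<n; m%n%n≡m%n; m<n⇒m%n≡m; m*n%n≡0; n%n≡0; %-distribˡ-+; %-distribˡ-*)
open import Data.Nat.Divisibility using (m%n≡0⇒n∣m; n∣m⇒m%n≡0)
open import Data.Nat.Primality using (Prime; euclidsLemma; prime⇒nonTrivial)
import Data.Nat.Properties as ℕₚ
open import Data.Product using (Σ-syntax; _×_; _,_; proj₁; proj₂)
open import Data.Sum as Sum using (_⊎_; inj₁; inj₂; [_,_]′)
open import Level using (0ℓ; _⊔_)
open import Relation.Binary.Bundles using (Setoid)
open import Relation.Binary.PropositionalEquality as ≡ using (_≡_; _≢_)
open import Relation.Nullary using (¬_; Dec; yes; no; does)

-- The delicate point in Stepanov's method is that a nonzero choice of coefficients must give a
-- nonzero polynomial, although X^h and (X - 1)^h are algebraically dependent. This is settled one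
-- power of (X - 1)^h at a time. The lowest row has at most α β terms, and a nonzero polynomial with
-- at most k terms, of exponents below p, cannot vanish to order k at 1. This asks for α β ≤ h and h
-- β ≤ p; the second condition, with β = 2 q^6, is the origin of h^(7/5) = O(p).
--
-- The best α and β bound the total size of n classes by O((n h)^(2/3)). Only n = 1 and n = q^3 are
-- treated, and they are matched: in ∑ T(u)² the small classes contribute h (q^9)² and the large
-- ones q^3 (q^10)^3, both q^33. Running through all dyadic n would lower the loss q^3 = h^(1/5) to
-- a logarithm, but 19/10 already exceeds 151/80. Measuring h by a fifteenth power makes all the
-- parameters whole powers of q.

module Polynomials {c ℓ} (R : CommutativeRing c ℓ) where
  open CommutativeRing R
  open import Algebra.Properties.Semiring.Exp semiring using (_^_)
  open import Algebra.Properties.Ring ring using (+-cancelʳ)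
  open import Algebra.Solver.Ring.NaturalCoefficients.Default commutativeSemiring
    using (solve; _:=_; _:+_; _:*_; con)
  module ≈-Reasoning where
    open import Relation.Binary.Reasoning.Setoid setoid public

  -- Polynomials as lists of coefficients

  Poly : Set c
  Poly = List Carrier

  coeff : Poly → ℕ → Carrier
  coeff []      _       = 0#
  coeff (a ∷ P) zero    = a
  coeff (a ∷ P) (suc k) = coeff P k

  infix 4 _≋_
  -- Trailing zeros are allowed, so that no coefficient ever has to be tested for being zero. The
  -- length of a list is therefore only an upper bound for the degree plus one.
  record _≋_ (P Q : Poly) : Set ℓ where
    constructor mk≋
    field at : ∀ k → coeff P k ≈ coeff Q k
  open _≋_ public

  ≋-setoid : Setoid c ℓ
  ≋-setoid = record
    { _≈_ = _≋_
    ; isEquivalence = record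
      { refl  = mk≋ λ _ → refl
      ; sym   = λ p → mk≋ λ k → sym (at p k)
      ; trans = λ p q → mk≋ λ k → trans (at p k) (at q k)
      }
    }
  module ≋ = Setoid ≋-setoid
  module ≋-Reasoning where
    open import Relation.Binary.Reasoning.Setoid ≋-setoid public

  coeff-≥length : ∀ P {k} → length P ℕ.≤ k → coeff P k ≡ 0#
  coeff-≥length []      _         = ≡.refl
  coeff-≥length (a ∷ P) (s≤s l≤k) = coeff-≥length P l≤k

  ι : ℕ → Carrier
  ι zero    = 0#
  ι (suc n) = 1# + ι n

  NoZeroDivisors : Set (c ⊔ ℓ)
  NoZeroDivisors = ∀ {x y} → x * y ≈ 0# → x ≈ 0# ⊎ y ≈ 0#

  -- The form in which the characteristic enters: for positive p, it is 0 or at least p.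
  ι-InjectiveBelow : ℕ → Set ℓ
  ι-InjectiveBelow p = ∀ {m n} → m ℕ.< p → n ℕ.< p → ι m ≈ ι n → m ≡ n

  infixl 6 _⊕_
  _⊕_ : Poly → Poly → Poly
  []      ⊕ Q       = Q
  (a ∷ P) ⊕ []      = a ∷ P
  (a ∷ P) ⊕ (b ∷ Q) = a + b ∷ P ⊕ Q

  scale : Carrier → Poly → Poly
  scale a []      = []
  scale a (b ∷ P) = a * b ∷ scale a P

  shift : Poly → Poly
  shift P = 0# ∷ P

  -- X d/dX
  θ-from : ℕ → Poly → Poly
  θ-from i []      = []
  θ-from i (a ∷ P) = ι i * a ∷ θ-from (suc i) P

  θ : Poly → Poly
  θ = θ-from 0

  -- Multiplication by X + a. Products with X and with X + a are the only ones needed.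
  lin : Carrier → Poly → Poly
  lin a P = shift P ⊕ scale a P

  coeff-⊕ : ∀ P Q k → coeff (P ⊕ Q) k ≈ coeff P k + coeff Q k
  coeff-⊕ []      Q       k       = sym (+-identityˡ _)
  coeff-⊕ (a ∷ P) []      k       = sym (+-identityʳ _)
  coeff-⊕ (a ∷ P) (b ∷ Q) zero    = refl
  coeff-⊕ (a ∷ P) (b ∷ Q) (suc k) = coeff-⊕ P Q k

  coeff-scale : ∀ a P k → coeff (scale a P) k ≈ a * coeff P k
  coeff-scale a []      k       = sym (zeroʳ a)
  coeff-scale a (b ∷ P) zero    = refl
  coeff-scale a (b ∷ P) (suc k) = coeff-scale a P k

  coeff-θ-from : ∀ i P k → coeff (θ-from i P) k ≈ ι (i ℕ.+ k) * coeff P k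
  coeff-θ-from i []      k    = sym (zeroʳ _)
  coeff-θ-from i (a ∷ P) zero rewrite ℕₚ.+-identityʳ i = refl
  coeff-θ-from i (a ∷ P) (suc k) rewrite ℕₚ.+-suc i k = coeff-θ-from (suc i) P k

  coeff-θ : ∀ P k → coeff (θ P) k ≈ ι k * coeff P k
  coeff-θ = coeff-θ-from 0

  coeff-lin-zero : ∀ a P → coeff (lin a P) 0 ≈ a * coeff P 0
  coeff-lin-zero a P = trans (coeff-⊕ (shift P) (scale a P) 0)
    (trans (+-identityˡ _) (coeff-scale a P 0))

  coeff-lin-suc : ∀ a P k → coeff (lin a P) (suc k) ≈ coeff P k + a * coeff P (suc k)
  coeff-lin-suc a P k = trans (coeff-⊕ (shift P) (scale a P) (suc k)) (+-congˡ (coeff-scale a P (suc k)))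

  ⊕-cong : ∀ {P P' Q Q'} → P ≋ P' → Q ≋ Q' → P ⊕ Q ≋ P' ⊕ Q'
  ⊕-cong {P} {P'} {Q} {Q'} p q = mk≋ λ k →
    trans (coeff-⊕ P Q k) (trans (+-cong (at p k) (at q k)) (sym (coeff-⊕ P' Q' k)))

  scale-cong : ∀ a {P Q} → P ≋ Q → scale a P ≋ scale a Q
  scale-cong a {P} {Q} p = mk≋ λ k →
    trans (coeff-scale a P k) (trans (*-congˡ (at p k)) (sym (coeff-scale a Q k)))

  shift-cong : ∀ {P Q} → P ≋ Q → shift P ≋ shift Q
  shift-cong p = mk≋ λ { zero → refl ; (suc k) → at p k }

  θ-cong : ∀ {P Q} → P ≋ Q → θ P ≋ θ Q
  θ-cong {P} {Q} p = mk≋ λ k →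
    trans (coeff-θ P k) (trans (*-congˡ (at p k)) (sym (coeff-θ Q k)))

  lin-cong : ∀ a {P Q} → P ≋ Q → lin a P ≋ lin a Q
  lin-cong a p = ⊕-cong (shift-cong p) (scale-cong a p)

  -- X + a is monic, so each coefficient of P can be read off from the product and the next higher
  -- coefficient of P. The induction runs downwards from an index beyond both lengths, where all
  -- coefficients are zero.
  lin-injective : ∀ a {P Q} → lin a P ≋ lin a Q → P ≋ Q
  lin-injective a {P} {Q} eq = mk≋ λ k → descend (bound ℕ.∸ k) k (ℕₚ.m≤n+m∸n bound k)
    where
    open ≈-Reasoning
    bound = length P ℕ.+ length Q
    descend : ∀ d k → bound ℕ.≤ k ℕ.+ d → coeff P k ≈ coeff Q k
    descend zero    k b≤k rewrite ℕₚ.+-identityʳ k = reflexive (≡.trans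
      (coeff-≥length P (ℕₚ.≤-trans (ℕₚ.m≤m+n _ _) b≤k))
      (≡.sym (coeff-≥length Q (ℕₚ.≤-trans (ℕₚ.m≤n+m _ _) b≤k))))
    descend (suc d) k b≤k = +-cancelʳ (a * coeff Q (suc k)) _ _ (begin
      coeff P k + a * coeff Q (suc k) ≈⟨ +-congˡ (*-congˡ (descend d (suc k) (ℕₚ.≤-trans b≤k (ℕₚ.≤-reflexive (ℕₚ.+-suc k d))))) ⟨
      coeff P k + a * coeff P (suc k) ≈⟨ coeff-lin-suc a P k ⟨
      coeff (lin a P) (suc k)         ≈⟨ at eq (suc k) ⟩
      coeff (lin a Q) (suc k)         ≈⟨ coeff-lin-suc a Q k ⟩
      coeff Q k + a * coeff Q (suc k) ∎)

  lin-⊕ : ∀ a P Q → lin a (P ⊕ Q) ≋ lin a P ⊕ lin a Q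
  lin-⊕ a P Q = mk≋ λ where
    zero → begin
      coeff (lin a (P ⊕ Q)) 0               ≈⟨ coeff-lin-zero a (P ⊕ Q) ⟩
      a * coeff (P ⊕ Q) 0                   ≈⟨ *-congˡ (coeff-⊕ P Q 0) ⟩
      a * (coeff P 0 + coeff Q 0)           ≈⟨ distribˡ a _ _ ⟩
      a * coeff P 0 + a * coeff Q 0         ≈⟨ +-cong (coeff-lin-zero a P) (coeff-lin-zero a Q) ⟨
      coeff (lin a P) 0 + coeff (lin a Q) 0 ≈⟨ coeff-⊕ (lin a P) (lin a Q) 0 ⟨
      coeff (lin a P ⊕ lin a Q) 0           ∎
    (suc k) → begin
      coeff (lin a (P ⊕ Q)) (suc k)
        ≈⟨ coeff-lin-suc a (P ⊕ Q) k ⟩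
      coeff (P ⊕ Q) k + a * coeff (P ⊕ Q) (suc k)
        ≈⟨ +-cong (coeff-⊕ P Q k) (*-congˡ (coeff-⊕ P Q (suc k))) ⟩
      (coeff P k + coeff Q k) + a * (coeff P (suc k) + coeff Q (suc k))
        ≈⟨ solve 5 (λ a p q p' q' → (p :+ q) :+ a :* (p' :+ q') := (p :+ a :* p') :+ (q :+ a :* q'))
             refl a (coeff P k) (coeff Q k) (coeff P (suc k)) (coeff Q (suc k)) ⟩
      (coeff P k + a * coeff P (suc k)) + (coeff Q k + a * coeff Q (suc k))
        ≈⟨ +-cong (coeff-lin-suc a P k) (coeff-lin-suc a Q k) ⟨
      coeff (lin a P) (suc k) + coeff (lin a Q) (suc k)
        ≈⟨ coeff-⊕ (lin a P) (lin a Q) (suc k) ⟨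
      coeff (lin a P ⊕ lin a Q) (suc k) ∎
   where open ≈-Reasoning

  lin-scale : ∀ a b P → lin a (scale b P) ≋ scale b (lin a P)
  lin-scale a b P = mk≋ λ where
    zero → begin
      coeff (lin a (scale b P)) 0 ≈⟨ coeff-lin-zero a (scale b P) ⟩
      a * coeff (scale b P) 0     ≈⟨ *-congˡ (coeff-scale b P 0) ⟩
      a * (b * coeff P 0)         ≈⟨ solve 3 (λ a b p → a :* (b :* p) := b :* (a :* p)) refl a b _ ⟩
      b * (a * coeff P 0)         ≈⟨ *-congˡ (coeff-lin-zero a P) ⟨
      b * coeff (lin a P) 0       ≈⟨ coeff-scale b (lin a P) 0 ⟨
      coeff (scale b (lin a P)) 0 ∎
    (suc k) → begin
      coeff (lin a (scale b P)) (suc k)                     ≈⟨ coeff-lin-suc a (scale b P) k ⟩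
      coeff (scale b P) k + a * coeff (scale b P) (suc k)   ≈⟨ +-cong (coeff-scale b P k) (*-congˡ (coeff-scale b P (suc k))) ⟩
      b * coeff P k + a * (b * coeff P (suc k))
        ≈⟨ solve 4 (λ a b p p' → b :* p :+ a :* (b :* p') := b :* (p :+ a :* p')) refl a b _ _ ⟩
      b * (coeff P k + a * coeff P (suc k))                 ≈⟨ *-congˡ (coeff-lin-suc a P k) ⟨
      b * coeff (lin a P) (suc k)                           ≈⟨ coeff-scale b (lin a P) (suc k) ⟨
      coeff (scale b (lin a P)) (suc k)                     ∎
   where open ≈-Reasoning

  lin-shift : ∀ a P → lin a (shift P) ≋ shift (lin a P)
  lin-shift a P = mk≋ λ where
    zero          → trans (coeff-lin-zero a (shift P)) (zeroʳ a)
    (suc zero)    → trans (coeff-lin-suc a (shift P) 0) (trans (+-identityˡ _) (sym (coeff-lin-zero a P)))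
    (suc (suc k)) → trans (coeff-lin-suc a (shift P) (suc k)) (sym (coeff-lin-suc a P k))

  lin-comm : ∀ a b P → lin a (lin b P) ≋ lin b (lin a P)
  lin-comm a b P = begin
    lin a (shift P ⊕ scale b P)             ≈⟨ lin-⊕ a (shift P) (scale b P) ⟩
    lin a (shift P) ⊕ lin a (scale b P)     ≈⟨ ⊕-cong (lin-shift a P) (lin-scale a b P) ⟩
    lin b (lin a P)                         ∎
    where open ≋-Reasoning

  θ-shift : ∀ P → θ (shift P) ≋ shift (θ P) ⊕ shift P
  θ-shift P = mk≋ λ where
    zero → trans (coeff-θ (shift P) 0) (trans (zeroʳ _) (sym (+-identityʳ _)))
    (suc k) → begin
      coeff (θ (shift P)) (suc k)   ≈⟨ coeff-θ (shift P) (suc k) ⟩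
      (1# + ι k) * coeff P k        ≈⟨ solve 2 (λ i p → (con 1 :+ i) :* p := i :* p :+ p) refl (ι k) _ ⟩
      ι k * coeff P k + coeff P k   ≈⟨ +-congʳ (coeff-θ P k) ⟨
      coeff (θ P) k + coeff P k     ≈⟨ coeff-⊕ (θ P) P k ⟨
      coeff (θ P ⊕ P) k             ∎
   where open ≈-Reasoning

  θ-⊕ : ∀ P Q → θ (P ⊕ Q) ≋ θ P ⊕ θ Q
  θ-⊕ P Q = mk≋ λ k → begin
    coeff (θ (P ⊕ Q)) k                   ≈⟨ coeff-θ (P ⊕ Q) k ⟩
    ι k * coeff (P ⊕ Q) k                 ≈⟨ *-congˡ (coeff-⊕ P Q k) ⟩
    ι k * (coeff P k + coeff Q k)         ≈⟨ distribˡ _ _ _ ⟩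
    ι k * coeff P k + ι k * coeff Q k     ≈⟨ +-cong (coeff-θ P k) (coeff-θ Q k) ⟨
    coeff (θ P) k + coeff (θ Q) k         ≈⟨ coeff-⊕ (θ P) (θ Q) k ⟨
    coeff (θ P ⊕ θ Q) k                   ∎
    where open ≈-Reasoning

  θ-scale : ∀ a P → θ (scale a P) ≋ scale a (θ P)
  θ-scale a P = mk≋ λ k → begin
    coeff (θ (scale a P)) k   ≈⟨ coeff-θ (scale a P) k ⟩
    ι k * coeff (scale a P) k ≈⟨ *-congˡ (coeff-scale a P k) ⟩
    ι k * (a * coeff P k)     ≈⟨ solve 3 (λ i a p → i :* (a :* p) := a :* (i :* p)) refl (ι k) a _ ⟩
    a * (ι k * coeff P k)     ≈⟨ *-congˡ (coeff-θ P k) ⟨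
    a * coeff (θ P) k         ≈⟨ coeff-scale a (θ P) k ⟨
    coeff (scale a (θ P)) k   ∎
    where open ≈-Reasoning

  ⊕-assoc : ∀ P Q S → (P ⊕ Q) ⊕ S ≋ P ⊕ (Q ⊕ S)
  ⊕-assoc P Q S = mk≋ λ k → begin
    coeff ((P ⊕ Q) ⊕ S) k               ≈⟨ coeff-⊕ (P ⊕ Q) S k ⟩
    coeff (P ⊕ Q) k + coeff S k         ≈⟨ +-congʳ (coeff-⊕ P Q k) ⟩
    coeff P k + coeff Q k + coeff S k   ≈⟨ +-assoc _ _ _ ⟩
    coeff P k + (coeff Q k + coeff S k) ≈⟨ +-congˡ (coeff-⊕ Q S k) ⟨
    coeff P k + coeff (Q ⊕ S) k         ≈⟨ coeff-⊕ P (Q ⊕ S) k ⟨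
    coeff (P ⊕ (Q ⊕ S)) k               ∎
    where open ≈-Reasoning

  ⊕-comm : ∀ P Q → P ⊕ Q ≋ Q ⊕ P
  ⊕-comm P Q = mk≋ λ k → trans (coeff-⊕ P Q k) (trans (+-comm _ _) (sym (coeff-⊕ Q P k)))

  scale-⊕ : ∀ a P Q → scale a (P ⊕ Q) ≋ scale a P ⊕ scale a Q
  scale-⊕ a P Q = mk≋ λ k → begin
    coeff (scale a (P ⊕ Q)) k                 ≈⟨ coeff-scale a (P ⊕ Q) k ⟩
    a * coeff (P ⊕ Q) k                       ≈⟨ *-congˡ (coeff-⊕ P Q k) ⟩
    a * (coeff P k + coeff Q k)               ≈⟨ distribˡ a _ _ ⟩
    a * coeff P k + a * coeff Q k             ≈⟨ +-cong (coeff-scale a P k) (coeff-scale a Q k) ⟨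
    coeff (scale a P) k + coeff (scale a Q) k ≈⟨ coeff-⊕ (scale a P) (scale a Q) k ⟨
    coeff (scale a P ⊕ scale a Q) k           ∎
    where open ≈-Reasoning

  scale-scale : ∀ a b P → scale a (scale b P) ≋ scale b (scale a P)
  scale-scale a b P = mk≋ λ k → begin
    coeff (scale a (scale b P)) k ≈⟨ coeff-scale a (scale b P) k ⟩
    a * coeff (scale b P) k       ≈⟨ *-congˡ (coeff-scale b P k) ⟩
    a * (b * coeff P k)           ≈⟨ solve 3 (λ a b p → a :* (b :* p) := b :* (a :* p)) refl a b _ ⟩
    b * (a * coeff P k)           ≈⟨ *-congˡ (coeff-scale a P k) ⟨
    b * coeff (scale a P) k       ≈⟨ coeff-scale b (scale a P) k ⟨
    coeff (scale b (scale a P)) k ∎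
    where open ≈-Reasoning

  θ-lin : ∀ a P → θ (lin a P) ≋ lin a (θ P) ⊕ shift P
  θ-lin a P = begin
    θ (shift P ⊕ scale a P)                  ≈⟨ θ-⊕ (shift P) (scale a P) ⟩
    θ (shift P) ⊕ θ (scale a P)              ≈⟨ ⊕-cong (θ-shift P) (θ-scale a P) ⟩
    (shift (θ P) ⊕ shift P) ⊕ scale a (θ P)  ≈⟨ ⊕-assoc (shift (θ P)) (shift P) (scale a (θ P)) ⟩
    shift (θ P) ⊕ (shift P ⊕ scale a (θ P))  ≈⟨ ⊕-cong (≋.refl {shift (θ P)}) (⊕-comm (shift P) (scale a (θ P))) ⟩
    shift (θ P) ⊕ (scale a (θ P) ⊕ shift P)  ≈⟨ ⊕-assoc (shift (θ P)) (scale a (θ P)) (shift P) ⟨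
    lin a (θ P) ⊕ shift P                    ∎
    where open ≋-Reasoning

  length-⊕ : ∀ {n} P Q → length P ℕ.≤ n → length Q ℕ.≤ n → length (P ⊕ Q) ℕ.≤ n
  length-⊕ []      Q       _         q         = q
  length-⊕ (a ∷ P) []      p         _         = p
  length-⊕ (a ∷ P) (b ∷ Q) (s≤s p)   (s≤s q)   = s≤s (length-⊕ P Q p q)

  length-scale : ∀ a P → length (scale a P) ≡ length P
  length-scale a []      = ≡.refl
  length-scale a (b ∷ P) = ≡.cong suc (length-scale a P)

  length-θ-from : ∀ i P → length (θ-from i P) ≡ length P
  length-θ-from i []      = ≡.refl
  length-θ-from i (a ∷ P) = ≡.cong suc (length-θ-from (suc i) P)

  length-lin : ∀ {n} a P → length P ℕ.≤ n → length (lin a P) ℕ.≤ suc n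
  length-lin a P p = length-⊕ (shift P) (scale a P) (s≤s p)
    (ℕₚ.≤-trans (ℕₚ.≤-reflexive (length-scale a P)) (ℕₚ.m≤n⇒m≤1+n p))

  eval : Poly → Carrier → Carrier
  eval []      x = 0#
  eval (a ∷ P) x = a + x * eval P x

  eval-≋[] : ∀ P x → P ≋ [] → eval P x ≈ 0#
  eval-≋[] []      x _ = refl
  eval-≋[] (a ∷ P) x p = trans (+-cong (at p 0) (trans (*-congˡ (eval-≋[] P x (mk≋ λ k → at p (suc k)))) (zeroʳ x)))
    (+-identityˡ _)

  eval-cong : ∀ P Q x → P ≋ Q → eval P x ≈ eval Q x
  eval-cong []      Q       x p = sym (eval-≋[] Q x (≋.sym p))
  eval-cong (a ∷ P) []      x p = eval-≋[] (a ∷ P) x p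
  eval-cong (a ∷ P) (b ∷ Q) x p = +-cong (at p 0) (*-congˡ (eval-cong P Q x (mk≋ λ k → at p (suc k))))

  eval-⊕ : ∀ P Q x → eval (P ⊕ Q) x ≈ eval P x + eval Q x
  eval-⊕ []      Q       x = sym (+-identityˡ _)
  eval-⊕ (a ∷ P) []      x = sym (+-identityʳ _)
  eval-⊕ (a ∷ P) (b ∷ Q) x = trans (+-congˡ (*-congˡ (eval-⊕ P Q x)))
    (solve 5 (λ a b x p q → (a :+ b) :+ x :* (p :+ q) := (a :+ x :* p) :+ (b :+ x :* q)) refl a b x _ _)

  eval-scale : ∀ a P x → eval (scale a P) x ≈ a * eval P x
  eval-scale a []      x = sym (zeroʳ a)
  eval-scale a (b ∷ P) x = trans (+-congˡ (*-congˡ (eval-scale a P x)))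
    (solve 4 (λ a b x p → a :* b :+ x :* (a :* p) := a :* (b :+ x :* p)) refl a b x _)

  eval-shift : ∀ P x → eval (shift P) x ≈ x * eval P x
  eval-shift P x = +-identityˡ _

  eval-lin : ∀ a P x → eval (lin a P) x ≈ (x + a) * eval P x
  eval-lin a P x = trans (eval-⊕ (shift P) (scale a P) x)
    (trans (+-cong (eval-shift P x) (eval-scale a P x)) (sym (distribʳ _ x a)))

  eval-monomial : ∀ m P x → (∀ k → k ≡.≢ m → coeff P k ≈ 0#) → eval P x ≈ coeff P m * x ^ m
  eval-monomial m       []      x z = sym (zeroˡ _)
  eval-monomial zero    (a ∷ P) x z = trans
    (+-congˡ (trans (*-congˡ (eval-≋[] P x (mk≋ λ k → z (suc k) λ ()))) (zeroʳ x)))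
    (trans (+-identityʳ a) (sym (*-identityʳ a)))
  eval-monomial (suc m) (a ∷ P) x z = begin
    a + x * eval P x         ≈⟨ +-cong (z 0 λ ()) (*-congˡ (eval-monomial m P x λ k k≢m → z (suc k) λ { ≡.refl → k≢m ≡.refl })) ⟩
    0# + x * (coeff P m * x ^ m) ≈⟨ solve 3 (λ x p y → con 0 :+ x :* (p :* y) := p :* (x :* y)) refl x _ _ ⟩
    coeff P m * (x * x ^ m)  ∎
    where open ≈-Reasoning

  -- Synthetic division: the coefficients of the quotient are the Horner values of the tails.
  tail-values : Carrier → Poly → Poly
  tail-values x []      = []
  tail-values x (a ∷ P) = eval (a ∷ P) x ∷ tail-values x P

  quotient : Carrier → Poly → Poly
  quotient x []      = []
  quotient x (_ ∷ P) = tail-values x P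

  length-tail-values : ∀ x P → length (tail-values x P) ≡ length P
  length-tail-values x []      = ≡.refl
  length-tail-values x (a ∷ P) = ≡.cong suc (length-tail-values x P)

  length-quotient : ∀ x P → length (quotient x P) ≡ length P ℕ.∸ 1
  length-quotient x []      = ≡.refl
  length-quotient x (_ ∷ P) = length-tail-values x P

  coeff₀-tail-values : ∀ x P → coeff (tail-values x P) 0 ≈ eval P x
  coeff₀-tail-values x []      = refl
  coeff₀-tail-values x (a ∷ P) = refl

  tail-values-step : ∀ {x a} → x + a ≈ 0# → ∀ P k →
    coeff (tail-values x P) k + a * coeff (tail-values x P) (suc k) ≈ coeff P k
  tail-values-step {x} {a} x+a []      k = trans (+-identityˡ _) (zeroʳ a)
  tail-values-step {x} {a} x+a (b ∷ P) (suc k) = tail-values-step x+a P k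
  tail-values-step {x} {a} x+a (b ∷ P) zero = begin
    (b + x * eval P x) + a * coeff (tail-values x P) 0 ≈⟨ +-congˡ (*-congˡ (coeff₀-tail-values x P)) ⟩
    (b + x * eval P x) + a * eval P x ≈⟨ solve 4 (λ b x p a → (b :+ x :* p) :+ a :* p := b :+ (x :+ a) :* p) refl b x _ a ⟩
    b + (x + a) * eval P x            ≈⟨ +-congˡ (*-congʳ x+a) ⟩
    b + 0# * eval P x                 ≈⟨ +-congˡ (zeroˡ _) ⟩
    b + 0#                            ≈⟨ +-identityʳ b ⟩
    b                                 ∎
    where open ≈-Reasoning

  factor : ∀ {x a} → x + a ≈ 0# → ∀ P → eval P x ≈ 0# → P ≋ lin a (quotient x P)
  factor {x} {a} x+a []      _  = mk≋ λ { zero → refl ; (suc k) → refl }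
  factor {x} {a} x+a (b ∷ P) Px = mk≋ λ where
    zero → begin
      b                                  ≈⟨ +-cancelʳ (x * eval P x) _ _ (begin
        b + x * eval P x                   ≈⟨ Px ⟩
        0#                                 ≈⟨ zeroˡ _ ⟨
        0# * eval P x                      ≈⟨ *-congʳ (trans (+-comm a x) x+a) ⟨
        (a + x) * eval P x                 ≈⟨ distribʳ _ a x ⟩
        a * eval P x + x * eval P x        ∎) ⟩
      a * eval P x                       ≈⟨ *-congˡ (coeff₀-tail-values x P) ⟨
      a * coeff (tail-values x P) 0      ≈⟨ coeff-lin-zero a (tail-values x P) ⟨
      coeff (lin a (tail-values x P)) 0  ∎
    (suc k) → sym (trans (coeff-lin-suc a (tail-values x P) k) (tail-values-step x+a P k))
   where open ≈-Reasoning

  shift^ : ℕ → Poly → Poly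
  shift^ zero    P = P
  shift^ (suc h) P = shift (shift^ h P)

  lin^ : Carrier → ℕ → Poly → Poly
  lin^ a zero    P = P
  lin^ a (suc h) P = lin a (lin^ a h P)

  coeff-shift^-< : ∀ h P {k} → k ℕ.< h → coeff (shift^ h P) k ≈ 0#
  coeff-shift^-< (suc h) P {zero}  _         = refl
  coeff-shift^-< (suc h) P {suc k} (s≤s k<h) = coeff-shift^-< h P k<h

  coeff-shift^-+ : ∀ h P k → coeff (shift^ h P) (h ℕ.+ k) ≈ coeff P k
  coeff-shift^-+ zero    P k = refl
  coeff-shift^-+ (suc h) P k = coeff-shift^-+ h P k

  length-shift^ : ∀ h P → length (shift^ h P) ≡ h ℕ.+ length P
  length-shift^ zero    P = ≡.refl
  length-shift^ (suc h) P = ≡.cong suc (length-shift^ h P)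

  length-lin^ : ∀ {n} a h P → length P ℕ.≤ n → length (lin^ a h P) ℕ.≤ h ℕ.+ n
  length-lin^ a zero    P p = p
  length-lin^ a (suc h) P p = length-lin a (lin^ a h P) (length-lin^ a h P p)

  eval-shift^ : ∀ h P x → eval (shift^ h P) x ≈ x ^ h * eval P x
  eval-shift^ zero    P x = sym (*-identityˡ _)
  eval-shift^ (suc h) P x = trans (eval-shift (shift^ h P) x)
    (trans (*-congˡ (eval-shift^ h P x)) (sym (*-assoc _ _ _)))

  eval-lin^ : ∀ a h P x → eval (lin^ a h P) x ≈ (x + a) ^ h * eval P x
  eval-lin^ a zero    P x = sym (*-identityˡ _)
  eval-lin^ a (suc h) P x = trans (eval-lin a (lin^ a h P) x)
    (trans (*-congˡ (eval-lin^ a h P x)) (sym (*-assoc _ _ _)))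

  lin^-cong : ∀ a h {P Q} → P ≋ Q → lin^ a h P ≋ lin^ a h Q
  lin^-cong a zero    p = p
  lin^-cong a (suc h) p = lin-cong a (lin^-cong a h p)

  lin^-injective : ∀ a h {P Q} → lin^ a h P ≋ lin^ a h Q → P ≋ Q
  lin^-injective a zero    p = p
  lin^-injective a (suc h) p = lin^-injective a h (lin-injective a p)

  lin^-⊕ : ∀ a h P Q → lin^ a h (P ⊕ Q) ≋ lin^ a h P ⊕ lin^ a h Q
  lin^-⊕ a zero    P Q = ≋.refl
  lin^-⊕ a (suc h) P Q = ≋.trans (lin-cong a (lin^-⊕ a h P Q)) (lin-⊕ a (lin^ a h P) (lin^ a h Q))

  lin^-scale : ∀ a h b P → lin^ a h (scale b P) ≋ scale b (lin^ a h P)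
  lin^-scale a zero    b P = ≋.refl
  lin^-scale a (suc h) b P = ≋.trans (lin-cong a (lin^-scale a h b P)) (lin-scale a b (lin^ a h P))

  lin^-shift : ∀ a h P → lin^ a h (shift P) ≋ shift (lin^ a h P)
  lin^-shift a zero    P = ≋.refl
  lin^-shift a (suc h) P = ≋.trans (lin-cong a (lin^-shift a h P)) (lin-shift a (lin^ a h P))

  lin^-lin : ∀ a h b P → lin^ a h (lin b P) ≋ lin b (lin^ a h P)
  lin^-lin a zero    b P = ≋.refl
  lin^-lin a (suc h) b P = ≋.trans (lin-cong a (lin^-lin a h b P)) (lin-comm a b (lin^ a h P))

  -- The product rule with (X + a)^k taken out, which shows that one derivative lowers the order of
  -- a zero by at most one.
  θ-lin^ : ∀ a k G → θ (lin^ a (suc k) G) ≋ lin^ a k (lin a (θ G) ⊕ scale (ι (suc k)) (shift G))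
  θ-lin^ a zero G = ≋.trans (θ-lin a G) (⊕-cong (≋.refl {lin a (θ G)}) (mk≋ λ where
    zero    → sym (zeroʳ _)
    (suc j) → sym (trans (coeff-scale _ G j) (trans (*-congʳ (+-identityʳ 1#)) (*-identityˡ _)))))
  θ-lin^ a (suc k) G = begin
    θ (lin a L)                            ≈⟨ θ-lin a L ⟩
    lin a (θ L) ⊕ shift L                  ≈⟨ ⊕-cong (lin-cong a (θ-lin^ a k G)) (≋.sym (lin^-shift a (suc k) G)) ⟩
    lin^ a (suc k) T ⊕ lin^ a (suc k) (shift G) ≈⟨ lin^-⊕ a (suc k) T (shift G) ⟨
    lin^ a (suc k) (T ⊕ shift G)           ≈⟨ lin^-cong a (suc k) (≋.trans (⊕-assoc (lin a (θ G)) _ _) (⊕-cong (≋.refl {lin a (θ G)}) one-more)) ⟩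
    lin^ a (suc k) (lin a (θ G) ⊕ scale (ι (suc (suc k))) (shift G)) ∎
    where
    open ≋-Reasoning
    L = lin^ a (suc k) G
    T = lin a (θ G) ⊕ scale (ι (suc k)) (shift G)
    one-more : scale (ι (suc k)) (shift G) ⊕ shift G ≋ scale (1# + ι (suc k)) (shift G)
    one-more = mk≋ λ j → trans (coeff-⊕ (scale (ι (suc k)) (shift G)) (shift G) j)
      (trans (+-congʳ (coeff-scale _ (shift G) j))
      (trans (solve 2 (λ i g → i :* g :+ g := (con 1 :+ i) :* g) refl (ι (suc k)) _)
      (sym (coeff-scale _ (shift G) j))))

-- Orders of vanishing

module Multiplicities {c ℓ} (R : CommutativeRing c ℓ) (noZeroDivisors : Polynomials.NoZeroDivisors R)
  (p : ℕ) (ι-injective : Polynomials.ι-InjectiveBelow R p) where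
  open CommutativeRing R
  open Polynomials R public
  open import Algebra.Properties.Semiring.Exp semiring using (_^_)
  open import Algebra.Properties.Ring ring using (+-cancelʳ)
  open import Algebra.Solver.Ring.NaturalCoefficients.Default commutativeSemiring
    using (solve; _:=_; _:+_; _:*_; con)

  -- Evaluation at y, the zero of X + b, takes the place of unique factorisation: X + a does not
  -- vanish at y, so H does. One factor X + b is then split off H and cancelled on both sides.
  coprime-step : ∀ {a b y} → y + b ≈ 0# → ¬ y + a ≈ 0# → ∀ j {H K} →
    lin a H ≋ lin^ b j K → Σ[ H' ∈ Poly ] H ≋ lin^ b j H'
  coprime-step y+b y+a zero    {H} eq = H , ≋.refl
  coprime-step {a} {b} {y} y+b y+a (suc j) {H} {K} eq =
    let H' , eq' = coprime-step y+b y+a j (lin-injective b {lin a Q} (≋.trans (lin-comm b a Q)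
                     (≋.trans (lin-cong a (≋.sym H≋)) eq)))
    in H' , ≋.trans H≋ (lin-cong b {Q} eq')
    where
    open ≈-Reasoning
    Q = quotient y H
    root : eval H y ≈ 0#
    root with noZeroDivisors (begin
      (y + a) * eval H y             ≈⟨ eval-lin a H y ⟨
      eval (lin a H) y               ≈⟨ eval-cong (lin a H) (lin^ b (suc j) K) y eq ⟩
      eval (lin b (lin^ b j K)) y    ≈⟨ eval-lin b (lin^ b j K) y ⟩
      (y + b) * eval (lin^ b j K) y  ≈⟨ *-congʳ y+b ⟩
      0# * eval (lin^ b j K) y       ≈⟨ zeroˡ _ ⟩
      0#                             ∎)
    ... | inj₁ z = ⊥-elim (y+a z)
    ... | inj₂ z = z
    H≋ : H ≋ lin b Q
    H≋ = factor y+b H root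

  coprime : ∀ {a b y} → y + b ≈ 0# → ¬ y + a ≈ 0# → ∀ i j {H K} →
    lin^ a i H ≋ lin^ b j K → Σ[ H' ∈ Poly ] H ≋ lin^ b j H'
  coprime y+b y+a zero    j {H} {K} eq = K , eq
  coprime y+b y+a (suc i) j         eq =
    let _ , eq' = coprime-step y+b y+a j eq in coprime y+b y+a i j eq'

  -- The given cofactor K may be padded with zeros. Repeated synthetic division yields one that is
  -- shorter by one for each factor, as the count of zeros requires.
  divide : ∀ {x a} → x + a ≈ 0# → ∀ j {P K} → P ≋ lin^ a j K →
    Σ[ G ∈ Poly ] P ≋ lin^ a j G × length G ℕ.≤ length P ℕ.∸ j
  divide x+a zero    {P} eq = P , ≋.refl , ℕₚ.≤-refl
  divide {x} {a} x+a (suc j) {P} {K} eq =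
    let G , eq' , l = divide x+a j (lin-injective a {quotient x P} (≋.trans (≋.sym P≋) eq))
    in G , ≋.trans P≋ (lin-cong a {quotient x P} eq') ,
       ℕₚ.≤-trans l (ℕₚ.≤-reflexive (≡.trans (≡.cong (ℕ._∸ j) (length-quotient x P)) (ℕₚ.∸-+-assoc (length P) 1 j)))
    where
    P≋ : P ≋ lin a (quotient x P)
    P≋ = factor x+a P (trans (eval-cong P (lin^ a (suc j) K) x eq)
      (trans (eval-lin a (lin^ a j K) x) (trans (*-congʳ x+a) (zeroˡ _))))

  lin^-[] : ∀ a k {P} → P ≋ [] → lin^ a k P ≋ []
  lin^-[] a zero    eq = eq
  lin^-[] a (suc k) {P} eq = ≋.trans (lin-cong a (lin^-[] a k {P} eq)) (mk≋ λ { zero → refl ; (suc _) → refl })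

  -- Splitting off the factor of one root shortens P by m, and `coprime` passes the divisibility by
  -- the factors of the other roots on to the quotient.
  too-many-roots : ∀ m {P} xs → AllPairs (λ x y → ¬ x ≈ y) xs →
    All (λ x → Σ[ K ∈ Poly ] P ≋ lin^ (- x) m K) xs →
    length P ℕ.≤ length xs ℕ.* m → P ≋ []
  too-many-roots m {[]} [] _ _ _ = ≋.refl
  too-many-roots m {P} (x ∷ xs) (x≉ ∷ distinct) ((K , eq) ∷ roots) l =
    let G , P≋ , l' = divide (-‿inverseʳ x) m eq
    in ≋.trans P≋ (lin^-[] (- x) m {G} (too-many-roots m xs distinct
         (All.zipWith (λ { {y} (x≉y , _ , eq') → coprime (-‿inverseʳ y)
             (λ z → x≉y (sym (+-cancelʳ (- x) _ _ (trans z (sym (-‿inverseʳ x))))))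
             m m (≋.trans (≋.sym P≋) eq') }) (x≉ , roots))
         (ℕₚ.≤-trans l' (ℕₚ.≤-trans (ℕₚ.∸-monoˡ-≤ m l) (ℕₚ.≤-reflexive (ℕₚ.m+n∸m≡n m _))))))

  module _ (e : Carrier) (1+e : 1# + e ≈ 0#) where

    -- θ - m removes the exponent m from the support and lowers the order of vanishing at 1 by one.
    sparse : ∀ E k {Q G} → Q ≋ lin^ e k G → length E ℕ.≤ k → All (ℕ._< p) E →
      (∀ j → j ∈ E ⊎ coeff Q j ≈ 0#) → Q ≋ []
    sparse []      k       eq _       _         supp = mk≋ λ j → [ (λ ()) , (λ z → z) ]′ (supp j)
    sparse (m ∷ E) (suc k) {Q} {G} eq (s≤s l) (m<p ∷ E<p) supp = mk≋ λ where
        j → [ (λ { ≡.refl → coeff-m }) , coeff-≢m j ]′ (dec j)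
      where
      open ≈-Reasoning
      Q' = θ Q ⊕ scale (- ι m) Q
      T = lin e (θ G) ⊕ scale (ι (suc k)) (shift G)
      Q'≋ : Q' ≋ lin^ e k (T ⊕ scale (- ι m) (lin e G))
      Q'≋ = ≋.trans (⊕-cong
          (≋.trans (θ-cong eq) (θ-lin^ e k G))
          (≋.trans (scale-cong (- ι m) (≋.trans eq (≋.sym (lin^-lin e k e G)))) (≋.sym (lin^-scale e k (- ι m) (lin e G)))))
        (≋.sym (lin^-⊕ e k T (scale (- ι m) (lin e G))))
      coeff-Q' : ∀ j → coeff Q' j ≈ (ι j + - ι m) * coeff Q j
      coeff-Q' j = trans (coeff-⊕ (θ Q) (scale (- ι m) Q) j)
        (trans (+-cong (coeff-θ Q j) (coeff-scale (- ι m) Q j)) (sym (distribʳ _ _ _)))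
      supp' : ∀ j → j ∈ E ⊎ coeff Q' j ≈ 0#
      supp' j with supp j
      ... | inj₁ (here ≡.refl) = inj₂ (trans (coeff-Q' m) (trans (*-congʳ (-‿inverseʳ _)) (zeroˡ _)))
      ... | inj₁ (there j∈E)   = inj₁ j∈E
      ... | inj₂ z             = inj₂ (trans (coeff-Q' j) (trans (*-congˡ z) (zeroʳ _)))
      dec : ∀ j → (j ≡ m) ⊎ (j ≢ m)
      dec j with j ℕ.≟ m
      ... | yes eq' = inj₁ eq'
      ... | no  neq = inj₂ neq
      coeff-≢m : ∀ j → j ≢ m → coeff Q j ≈ 0#
      coeff-≢m j j≢m with supp j
      ... | inj₂ z             = z
      ... | inj₁ (here eq')    = ⊥-elim (j≢m eq')
      -- The recursive call gives (j - m) Q_j = 0, and j - m is not zero in the ring because j and m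
      -- are distinct and below p.
      ... | inj₁ (there j∈E)
        with noZeroDivisors (trans (sym (coeff-Q' j)) (at (sparse E k Q'≋ l E<p supp') j))
      ...   | inj₂ z = z
      ...   | inj₁ z = ⊥-elim (j≢m (ι-injective (All.lookup E<p j∈E) m<p
                         (+-cancelʳ (- ι m) _ _ (trans z (sym (-‿inverseʳ _))))))
      1^ : ∀ n → 1# ^ n ≈ 1#
      1^ zero    = refl
      1^ (suc n) = trans (*-identityˡ _) (1^ n)
      -- All other coefficients being zero, Q is a multiple of X^m. Its value at 1 is the remaining
      -- coefficient, and Q(1) = 0 by divisibility.
      coeff-m : coeff Q m ≈ 0#
      coeff-m = begin
        coeff Q m                        ≈⟨ trans (*-congˡ (1^ m)) (*-identityʳ _) ⟨
        coeff Q m * 1# ^ m               ≈⟨ eval-monomial m Q 1# coeff-≢m ⟨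
        eval Q 1#                        ≈⟨ eval-cong Q (lin^ e (suc k) G) 1# eq ⟩
        eval (lin e (lin^ e k G)) 1#     ≈⟨ eval-lin e (lin^ e k G) 1# ⟩
        (1# + e) * eval (lin^ e k G) 1#  ≈⟨ *-congʳ 1+e ⟩
        0# * eval (lin^ e k G) 1#        ≈⟨ zeroˡ _ ⟩
        0#                               ∎

  -- The derivation X (X + e) d/dX and its iterates

  module Derivation (e : Carrier) where

    -- With D = X (X + e) d/dX one has D (X^s (X + e)^t P) = X^s (X + e)^t (δ s t P).
    δ : ℕ → ℕ → Poly → Poly
    δ s t P = lin e (θ P) ⊕ (scale (ι s) (lin e P) ⊕ scale (ι t) (shift P))

    coeff-δ-zero : ∀ s t P → coeff (δ s t P) 0 ≈ ι s * (e * coeff P 0)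
    coeff-δ-zero s t P = begin
      coeff (δ s t P) 0
        ≈⟨ trans (coeff-⊕ (lin e (θ P)) _ 0) (+-congˡ (coeff-⊕ (scale (ι s) (lin e P)) (scale (ι t) (shift P)) 0)) ⟩
      coeff (lin e (θ P)) 0 + (coeff (scale (ι s) (lin e P)) 0 + ι t * 0#)
        ≈⟨ +-cong (trans (coeff-lin-zero e (θ P)) (*-congˡ (coeff-θ P 0)))
             (+-congʳ (trans (coeff-scale (ι s) (lin e P) 0) (*-congˡ (coeff-lin-zero e P)))) ⟩
      e * (0# * coeff P 0) + (ι s * (e * coeff P 0) + ι t * 0#)
        ≈⟨ solve 4 (λ e s t x → e :* (con 0 :* x) :+ (s :* (e :* x) :+ t :* con 0) := s :* (e :* x)) refl e (ι s) (ι t) _ ⟩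
      ι s * (e * coeff P 0) ∎
      where open ≈-Reasoning

    coeff-δ-suc : ∀ s t P k → coeff (δ s t P) (suc k) ≈
      (ι k + (ι s + ι t)) * coeff P k + (1# + (ι k + ι s)) * (e * coeff P (suc k))
    coeff-δ-suc s t P k = begin
      coeff (δ s t P) (suc k)
        ≈⟨ trans (coeff-⊕ (lin e (θ P)) _ (suc k)) (+-congˡ (coeff-⊕ (scale (ι s) (lin e P)) (scale (ι t) (shift P)) (suc k))) ⟩
      coeff (lin e (θ P)) (suc k) + (coeff (scale (ι s) (lin e P)) (suc k) + coeff (scale (ι t) P) k)
        ≈⟨ +-cong (trans (coeff-lin-suc e (θ P) k) (+-cong (coeff-θ P k) (*-congˡ (coeff-θ P (suc k)))))
             (+-cong (trans (coeff-scale (ι s) (lin e P) (suc k)) (*-congˡ (coeff-lin-suc e P k))) (coeff-scale (ι t) P k)) ⟩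
      (ι k * coeff P k + e * ((1# + ι k) * coeff P (suc k))) + (ι s * (coeff P k + e * coeff P (suc k)) + ι t * coeff P k)
        ≈⟨ solve 6 (λ e s t k x y →
             (k :* x :+ e :* ((con 1 :+ k) :* y)) :+ (s :* (x :+ e :* y) :+ t :* x)
             := (k :+ (s :+ t)) :* x :+ (con 1 :+ (k :+ s)) :* (e :* y)) refl e (ι s) (ι t) (ι k) _ _ ⟩
      (ι k + (ι s + ι t)) * coeff P k + (1# + (ι k + ι s)) * (e * coeff P (suc k)) ∎
      where open ≈-Reasoning

    δ-cong : ∀ s t {P Q} → P ≋ Q → δ s t P ≋ δ s t Q
    δ-cong s t p = ⊕-cong (lin-cong e (θ-cong p)) (⊕-cong (scale-cong (ι s) (lin-cong e p)) (scale-cong (ι t) (shift-cong p)))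

    δ-⊕ : ∀ s t P Q → δ s t (P ⊕ Q) ≋ δ s t P ⊕ δ s t Q
    δ-⊕ s t P Q = mk≋ λ where
        zero → begin
          coeff (δ s t (P ⊕ Q)) 0                             ≈⟨ coeff-δ-zero s t (P ⊕ Q) ⟩
          ι s * (e * coeff (P ⊕ Q) 0)                         ≈⟨ *-congˡ (*-congˡ (coeff-⊕ P Q 0)) ⟩
          ι s * (e * (coeff P 0 + coeff Q 0))
            ≈⟨ solve 4 (λ s e x y → s :* (e :* (x :+ y)) := s :* (e :* x) :+ s :* (e :* y)) refl (ι s) e _ _ ⟩
          ι s * (e * coeff P 0) + ι s * (e * coeff Q 0)       ≈⟨ +-cong (coeff-δ-zero s t P) (coeff-δ-zero s t Q) ⟨
          coeff (δ s t P) 0 + coeff (δ s t Q) 0               ≈⟨ coeff-⊕ (δ s t P) (δ s t Q) 0 ⟨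
          coeff (δ s t P ⊕ δ s t Q) 0                         ∎
        (suc k) → begin
          coeff (δ s t (P ⊕ Q)) (suc k)
            ≈⟨ coeff-δ-suc s t (P ⊕ Q) k ⟩
          (ι k + (ι s + ι t)) * coeff (P ⊕ Q) k + (1# + (ι k + ι s)) * (e * coeff (P ⊕ Q) (suc k))
            ≈⟨ +-cong (*-congˡ (coeff-⊕ P Q k)) (*-congˡ (*-congˡ (coeff-⊕ P Q (suc k)))) ⟩
          (ι k + (ι s + ι t)) * (coeff P k + coeff Q k) + (1# + (ι k + ι s)) * (e * (coeff P (suc k) + coeff Q (suc k)))
            ≈⟨ solve 7 (λ a b e x y x' y' → a :* (x :+ y) :+ b :* (e :* (x' :+ y'))
                 := (a :* x :+ b :* (e :* x')) :+ (a :* y :+ b :* (e :* y'))) refl (ι k + (ι s + ι t)) (1# + (ι k + ι s)) e _ _ _ _ ⟩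
          _ ≈⟨ +-cong (coeff-δ-suc s t P k) (coeff-δ-suc s t Q k) ⟨
          coeff (δ s t P) (suc k) + coeff (δ s t Q) (suc k)   ≈⟨ coeff-⊕ (δ s t P) (δ s t Q) (suc k) ⟨
          coeff (δ s t P ⊕ δ s t Q) (suc k)                   ∎
      where open ≈-Reasoning

    δ-scale : ∀ s t b P → δ s t (scale b P) ≋ scale b (δ s t P)
    δ-scale s t b P = begin
      lin e (θ (scale b P)) ⊕ (scale (ι s) (lin e (scale b P)) ⊕ scale (ι t) (shift (scale b P)))
        ≈⟨ ⊕-cong (≋.trans (lin-cong e (θ-scale b P)) (lin-scale e b (θ P)))
             (⊕-cong (≋.trans (scale-cong (ι s) (lin-scale e b P)) (scale-scale (ι s) b (lin e P)))
                (≋.trans (scale-cong (ι t) shift-scale) (scale-scale (ι t) b (shift P)))) ⟩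
      scale b (lin e (θ P)) ⊕ (scale b (scale (ι s) (lin e P)) ⊕ scale b (scale (ι t) (shift P)))
        ≈⟨ ⊕-cong (≋.refl {scale b (lin e (θ P))}) (scale-⊕ b (scale (ι s) (lin e P)) (scale (ι t) (shift P))) ⟨
      scale b (lin e (θ P)) ⊕ scale b (scale (ι s) (lin e P) ⊕ scale (ι t) (shift P))
        ≈⟨ scale-⊕ b (lin e (θ P)) _ ⟨
      scale b (δ s t P) ∎
      where
      open ≋-Reasoning
      shift-scale : shift (scale b P) ≋ scale b (shift P)
      shift-scale = mk≋ λ { zero → sym (zeroʳ b) ; (suc k) → refl }

    -- A factor X may be counted in P or in the exponent s: both sides come from the derivative of
    -- X^(s+1) (X + e)^t P.
    δ-shift : ∀ s t P → δ s t (shift P) ≋ shift (δ (suc s) t P)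
    δ-shift s t P = mk≋ λ where
        zero → trans (coeff-δ-zero s t (shift P)) (trans (*-congˡ (zeroʳ e)) (zeroʳ _))
        (suc zero) → begin
          coeff (δ s t (shift P)) 1
            ≈⟨ coeff-δ-suc s t (shift P) 0 ⟩
          (0# + (ι s + ι t)) * 0# + (1# + (0# + ι s)) * (e * coeff P 0)
            ≈⟨ solve 4 (λ s t e x → (con 0 :+ (s :+ t)) :* con 0 :+ (con 1 :+ (con 0 :+ s)) :* (e :* x)
                 := (con 1 :+ s) :* (e :* x)) refl (ι s) (ι t) e _ ⟩
          (1# + ι s) * (e * coeff P 0)
            ≈⟨ coeff-δ-zero (suc s) t P ⟨
          coeff (δ (suc s) t P) 0 ∎
        (suc (suc k)) → begin
          coeff (δ s t (shift P)) (suc (suc k))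
            ≈⟨ coeff-δ-suc s t (shift P) (suc k) ⟩
          ((1# + ι k) + (ι s + ι t)) * coeff P k + (1# + ((1# + ι k) + ι s)) * (e * coeff P (suc k))
            ≈⟨ solve 6 (λ k s t e x y → ((con 1 :+ k) :+ (s :+ t)) :* x :+ (con 1 :+ ((con 1 :+ k) :+ s)) :* (e :* y)
                 := (k :+ ((con 1 :+ s) :+ t)) :* x :+ (con 1 :+ (k :+ (con 1 :+ s))) :* (e :* y)) refl (ι k) (ι s) (ι t) e _ _ ⟩
          (ι k + ((1# + ι s) + ι t)) * coeff P k + (1# + (ι k + (1# + ι s))) * (e * coeff P (suc k))
            ≈⟨ coeff-δ-suc (suc s) t P k ⟨
          coeff (δ (suc s) t P) (suc k) ∎
      where open ≈-Reasoning

    δ-lin : ∀ s t P → δ s t (lin e P) ≋ lin e (δ s (suc t) P)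
    δ-lin s t P = mk≋ λ where
        zero → begin
          coeff (δ s t (lin e P)) 0         ≈⟨ coeff-δ-zero s t (lin e P) ⟩
          ι s * (e * coeff (lin e P) 0)     ≈⟨ *-congˡ (*-congˡ (coeff-lin-zero e P)) ⟩
          ι s * (e * (e * coeff P 0))       ≈⟨ solve 3 (λ s e x → s :* (e :* (e :* x)) := e :* (s :* (e :* x))) refl (ι s) e _ ⟩
          e * (ι s * (e * coeff P 0))       ≈⟨ *-congˡ (coeff-δ-zero s (suc t) P) ⟨
          e * coeff (δ s (suc t) P) 0       ≈⟨ coeff-lin-zero e (δ s (suc t) P) ⟨
          coeff (lin e (δ s (suc t) P)) 0   ∎
        (suc zero) → begin
          coeff (δ s t (lin e P)) 1
            ≈⟨ coeff-δ-suc s t (lin e P) 0 ⟩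
          (0# + (ι s + ι t)) * coeff (lin e P) 0 + (1# + (0# + ι s)) * (e * coeff (lin e P) 1)
            ≈⟨ +-cong (*-congˡ (coeff-lin-zero e P)) (*-congˡ (*-congˡ (coeff-lin-suc e P 0))) ⟩
          (0# + (ι s + ι t)) * (e * coeff P 0) + (1# + (0# + ι s)) * (e * (coeff P 0 + e * coeff P 1))
            ≈⟨ solve 5 (λ s t e x y →
                 (con 0 :+ (s :+ t)) :* (e :* x) :+ (con 1 :+ (con 0 :+ s)) :* (e :* (x :+ e :* y))
                 := s :* (e :* x) :+ e :* ((con 0 :+ (s :+ (con 1 :+ t))) :* x :+ (con 1 :+ (con 0 :+ s)) :* (e :* y)))
                 refl (ι s) (ι t) e _ _ ⟩
          ι s * (e * coeff P 0) + e * ((0# + (ι s + (1# + ι t))) * coeff P 0 + (1# + (0# + ι s)) * (e * coeff P 1))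
            ≈⟨ +-cong (coeff-δ-zero s (suc t) P) (*-congˡ (coeff-δ-suc s (suc t) P 0)) ⟨
          coeff (δ s (suc t) P) 0 + e * coeff (δ s (suc t) P) 1
            ≈⟨ coeff-lin-suc e (δ s (suc t) P) 0 ⟨
          coeff (lin e (δ s (suc t) P)) 1 ∎
        (suc (suc k)) → begin
          coeff (δ s t (lin e P)) (suc (suc k))
            ≈⟨ coeff-δ-suc s t (lin e P) (suc k) ⟩
          ((1# + ι k) + (ι s + ι t)) * coeff (lin e P) (suc k) + (1# + ((1# + ι k) + ι s)) * (e * coeff (lin e P) (suc (suc k)))
            ≈⟨ +-cong (*-congˡ (coeff-lin-suc e P k)) (*-congˡ (*-congˡ (coeff-lin-suc e P (suc k)))) ⟩
          ((1# + ι k) + (ι s + ι t)) * (coeff P k + e * coeff P (suc k))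
            + (1# + ((1# + ι k) + ι s)) * (e * (coeff P (suc k) + e * coeff P (suc (suc k))))
            ≈⟨ solve 7 (λ k s t e x y z →
                 ((con 1 :+ k) :+ (s :+ t)) :* (x :+ e :* y) :+ (con 1 :+ ((con 1 :+ k) :+ s)) :* (e :* (y :+ e :* z))
                 := ((k :+ (s :+ (con 1 :+ t))) :* x :+ (con 1 :+ (k :+ s)) :* (e :* y))
                    :+ e :* (((con 1 :+ k) :+ (s :+ (con 1 :+ t))) :* y :+ (con 1 :+ ((con 1 :+ k) :+ s)) :* (e :* z)))
                 refl (ι k) (ι s) (ι t) e _ _ _ ⟩
          _ ≈⟨ +-cong (coeff-δ-suc s (suc t) P k) (*-congˡ (coeff-δ-suc s (suc t) P (suc k))) ⟨
          coeff (δ s (suc t) P) (suc k) + e * coeff (δ s (suc t) P) (suc (suc k))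
            ≈⟨ coeff-lin-suc e (δ s (suc t) P) (suc k) ⟨
          coeff (lin e (δ s (suc t) P)) (suc (suc k)) ∎
      where open ≈-Reasoning

    -- The growth does not depend on s and t. So the large factors X^{hc} (X + e)^{hb} add nothing
    -- to the number of conditions: they act only through the scalars `ι s` and `ι t`.
    length-δ : ∀ {n} s t P → length P ℕ.≤ n → length (δ s t P) ℕ.≤ suc n
    length-δ s t P l = length-⊕ (lin e (θ P)) _
      (length-lin e (θ P) (ℕₚ.≤-trans (ℕₚ.≤-reflexive (length-θ-from 0 P)) l))
      (length-⊕ (scale (ι s) (lin e P)) _
        (ℕₚ.≤-trans (ℕₚ.≤-reflexive (length-scale (ι s) (lin e P))) (length-lin e P l))
        (ℕₚ.≤-trans (ℕₚ.≤-reflexive (length-scale (ι t) (shift P))) (s≤s l)))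

    δ^ : ℕ → ℕ → ℕ → Poly → Poly
    δ^ s t zero    P = P
    δ^ s t (suc k) P = δ^ s t k (δ s t P)

    δ^-cong : ∀ s t k {P Q} → P ≋ Q → δ^ s t k P ≋ δ^ s t k Q
    δ^-cong s t zero    p = p
    δ^-cong s t (suc k) p = δ^-cong s t k (δ-cong s t p)

    δ^-⊕ : ∀ s t k P Q → δ^ s t k (P ⊕ Q) ≋ δ^ s t k P ⊕ δ^ s t k Q
    δ^-⊕ s t zero    P Q = ≋.refl
    δ^-⊕ s t (suc k) P Q = ≋.trans (δ^-cong s t k (δ-⊕ s t P Q)) (δ^-⊕ s t k (δ s t P) (δ s t Q))

    δ^-scale : ∀ s t k b P → δ^ s t k (scale b P) ≋ scale b (δ^ s t k P)
    δ^-scale s t zero    b P = ≋.refl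
    δ^-scale s t (suc k) b P = ≋.trans (δ^-cong s t k (δ-scale s t b P)) (δ^-scale s t k b (δ s t P))

    length-δ^ : ∀ {n} s t k P → length P ℕ.≤ n → length (δ^ s t k P) ℕ.≤ k ℕ.+ n
    length-δ^ s t zero    P l = l
    length-δ^ {n} s t (suc k) P l = ℕₚ.≤-trans (length-δ^ s t k (δ s t P) (length-δ s t P l)) (ℕₚ.≤-reflexive (ℕₚ.+-suc k n))

    δ-shift^ : ∀ s t h P → δ s t (shift^ h P) ≋ shift^ h (δ (h ℕ.+ s) t P)
    δ-shift^ s t zero    P = ≋.refl
    δ-shift^ s t (suc h) P = ≋.trans (δ-shift s t (shift^ h P)) (shift-cong
      (≋.trans (δ-shift^ (suc s) t h P) (≋.reflexive (≡.cong (λ n → shift^ h (δ n t P)) (ℕₚ.+-suc h s)))))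

    δ-lin^ : ∀ s t h P → δ s t (lin^ e h P) ≋ lin^ e h (δ s (h ℕ.+ t) P)
    δ-lin^ s t zero    P = ≋.refl
    δ-lin^ s t (suc h) P = ≋.trans (δ-lin s t (lin^ e h P)) (lin-cong e
      (≋.trans (δ-lin^ s (suc t) h P) (≋.reflexive (≡.cong (λ n → lin^ e h (δ s n P)) (ℕₚ.+-suc h t)))))

    δ^-shift^ : ∀ s t k h P → δ^ s t k (shift^ h P) ≋ shift^ h (δ^ (h ℕ.+ s) t k P)
    δ^-shift^ s t zero    h P = ≋.refl
    δ^-shift^ s t (suc k) h P = ≋.trans (δ^-cong s t k (δ-shift^ s t h P)) (δ^-shift^ s t k h (δ (h ℕ.+ s) t P))

    δ^-lin^ : ∀ s t k h P → δ^ s t k (lin^ e h P) ≋ lin^ e h (δ^ s (h ℕ.+ t) k P)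
    δ^-lin^ s t zero    h P = ≋.refl
    δ^-lin^ s t (suc k) h P = ≋.trans (δ^-cong s t k (δ-lin^ s t h P)) (δ^-lin^ s t k h (δ s (h ℕ.+ t) P))

    δ-zero-zero : ∀ P → δ 0 0 P ≋ lin e (θ P)
    δ-zero-zero P = mk≋ λ k → trans (coeff-⊕ (lin e (θ P)) _ k) (trans (+-congˡ
      (trans (coeff-⊕ (scale 0# (lin e P)) (scale 0# (shift P)) k)
        (trans (+-cong (coeff-scale 0# (lin e P) k) (coeff-scale 0# (shift P) k))
          (trans (+-cong (zeroˡ _) (zeroˡ _)) (+-identityˡ 0#))))) (+-identityʳ _))

    module _ {x a : Carrier} (x+a : x + a ≈ 0#) (x≉0 : ¬ x ≈ 0#) (x+e≉0 : ¬ x + e ≈ 0#) where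

      cofactor : ℕ → Poly → Poly
      cofactor i G = lin e (lin a (θ G) ⊕ scale (ι (suc i)) (shift G))

      δ-factor : ∀ i G → δ 0 0 (lin^ a (suc i) G) ≋ lin^ a i (cofactor i G)
      δ-factor i G = begin
        δ 0 0 (lin^ a (suc i) G)            ≈⟨ δ-zero-zero (lin^ a (suc i) G) ⟩
        lin e (θ (lin^ a (suc i) G))        ≈⟨ lin-cong e (θ-lin^ a i G) ⟩
        lin e (lin^ a i (lin a (θ G) ⊕ scale (ι (suc i)) (shift G)))
          ≈⟨ lin^-lin a i e (lin a (θ G) ⊕ scale (ι (suc i)) (shift G)) ⟨
        lin^ a i (cofactor i G)             ∎
        where open ≋-Reasoning

      eval-cofactor : ∀ i G → eval (cofactor i G) x ≈ (x + e) * (ι (suc i) * (x * eval G x))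
      eval-cofactor i G = trans (eval-lin e (lin a (θ G) ⊕ scale (ι (suc i)) (shift G)) x) (*-congˡ (begin
        eval (lin a (θ G) ⊕ scale (ι (suc i)) (shift G)) x
          ≈⟨ eval-⊕ (lin a (θ G)) (scale (ι (suc i)) (shift G)) x ⟩
        eval (lin a (θ G)) x + eval (scale (ι (suc i)) (shift G)) x
          ≈⟨ +-cong (trans (eval-lin a (θ G) x) (trans (*-congʳ x+a) (zeroˡ _)))
               (trans (eval-scale (ι (suc i)) (shift G) x) (*-congˡ (eval-shift G x))) ⟩
        0# + ι (suc i) * (x * eval G x) ≈⟨ +-identityˡ _ ⟩
        ι (suc i) * (x * eval G x) ∎))
        where open ≈-Reasoning

      cancel : ∀ {y z} → ¬ y ≈ 0# → y * z ≈ 0# → z ≈ 0#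
      cancel y≉0 yz with noZeroDivisors yz
      ... | inj₁ y≈0 = ⊥-elim (y≉0 y≈0)
      ... | inj₂ z≈0 = z≈0

      -- At x the i-th derivative of (X + a)^i G has the value i! (x (x + e))^i G(x), and the factor
      -- in front is nonzero because i < p and x is neither 0 nor - e.
      vanishing-cofactor : ∀ i → i ℕ.< p → ∀ G → eval (δ^ 0 0 i (lin^ a i G)) x ≈ 0# → eval G x ≈ 0#
      vanishing-cofactor zero    _   G z = z
      vanishing-cofactor (suc i) i<p G z =
        cancel x≉0 (cancel ι≉0 (cancel x+e≉0 (trans (sym (eval-cofactor i G))
          (vanishing-cofactor i (ℕₚ.<-trans (ℕₚ.n<1+n i) i<p) (cofactor i G)
            (trans (sym (eval-cong (δ^ 0 0 (suc i) (lin^ a (suc i) G)) _ x (δ^-cong 0 0 i (δ-factor i G)))) z)))))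
        where
        ι≉0 : ¬ ι (suc i) ≈ 0#
        ι≉0 w with () ← ι-injective i<p (ℕₚ.<-trans ℕ.z<s i<p) w

      -- Once (X + a)^j is split off, the vanishing of the j-th derivative at x forces the cofactor
      -- to vanish there, and one more factor comes off. As j stays below p, the factorials involved
      -- are invertible.
      multiplicity : ∀ j → j ℕ.≤ p → ∀ P → (∀ k → k ℕ.< j → eval (δ^ 0 0 k P) x ≈ 0#) →
        Σ[ G ∈ Poly ] P ≋ lin^ a j G
      multiplicity zero    _   P _ = P , ≋.refl
      multiplicity (suc j) j<p P z =
        let G , eq = multiplicity j (ℕₚ.<⇒≤ j<p) P (λ k k<j → z k (ℕₚ.m<n⇒m<1+n k<j))
            root = vanishing-cofactor j j<p G
              (trans (sym (eval-cong (δ^ 0 0 j P) (δ^ 0 0 j (lin^ a j G)) x (δ^-cong 0 0 j eq))) (z j ℕₚ.≤-refl))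
        in quotient x G , ≋.trans eq (≋.trans (lin^-cong a j (factor x+a G root)) (lin^-lin a j a (quotient x G)))

funToFin-cong : ∀ {m n} {f g : Fin m → Fin n} → (∀ i → f i ≡ g i) → funToFin f ≡ funToFin g
funToFin-cong {zero}  eq = ≡.refl
funToFin-cong {suc m} eq = ≡.cong₂ combine (eq Fin.zero) (funToFin-cong (λ i → eq (Fin.suc i)))

-- In place of linear algebra over a finite field: fewer equations than unknowns
-- leave fewer values than points.
collision : ∀ {p m n} → 1 ℕ.< p → m ℕ.< n → (Φ : (Fin n → Fin p) → Fin m → Fin p) →
  Σ[ u ∈ (Fin n → Fin p) ] Σ[ v ∈ (Fin n → Fin p) ] (¬ (∀ i → u i ≡ v i)) × (∀ i → Φ u i ≡ Φ v i)
collision {p} {m} {n} 1<p m<n Φ =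
  let i , j , i<j , eq = Finₚ.pigeonhole (ℕₚ.^-monoʳ-< p 1<p m<n) (λ I → funToFin (Φ (finToFun I)))
  in finToFun i , finToFun j
   , (λ u≗v → Finₚ.<⇒≢ i<j (≡.trans (≡.sym (Finₚ.funToFin-finToFin {n} i))
        (≡.trans (funToFin-cong u≗v) (Finₚ.funToFin-finToFin {n} j))))
   , λ k → ≡.trans (≡.sym (Finₚ.finToFun-funToFin (Φ (finToFun i)) k))
        (≡.trans (≡.cong (λ I → finToFun {p} {m} I k) eq) (Finₚ.finToFun-funToFin (Φ (finToFun j)) k))

-- The auxiliary polynomial and Stepanov's bound

module Stepanov {c ℓ} (R : CommutativeRing c ℓ) (noZeroDivisors : Polynomials.NoZeroDivisors R)
  (p : ℕ) (ι-injective : Polynomials.ι-InjectiveBelow R p) (1<p : 1 ℕ.< p)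
  (encode : CommutativeRing.Carrier R → Fin p)
  (encode-injective : ∀ {x y} → encode x ≡ encode y → CommutativeRing._≈_ R x y)
  (decode : Fin p → CommutativeRing.Carrier R)
  (decode-injective : ∀ {i j} → CommutativeRing._≈_ R (decode i) (decode j) → i ≡ j)
  where
  open CommutativeRing R
  open Multiplicities R noZeroDivisors p ι-injective
  open import Algebra.Properties.Semiring.Exp semiring using (_^_)
  open import Algebra.Properties.Ring ring using (+-cancelˡ)
  open import Algebra.Solver.Ring.NaturalCoefficients.Default commutativeSemiring
    using (solve; _:=_; _:+_; _:*_; con)

  e : Carrier
  e = - 1#

  1+e : 1# + e ≈ 0#
  1+e = -‿inverseʳ 1#

  open Derivation e

  x+ex : ∀ x → x + e * x ≈ 0#
  x+ex x = trans (solve 2 (λ x e → x :+ e :* x := (con 1 :+ e) :* x) refl x e) (trans (*-congʳ 1+e) (zeroˡ x))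

  ⊕-scale≋[] : ∀ P Q → P ⊕ scale e Q ≋ [] → P ≋ Q
  ⊕-scale≋[] P Q eq = mk≋ λ k → begin
    coeff P k                                   ≈⟨ +-identityʳ _ ⟨
    coeff P k + 0#                              ≈⟨ +-congˡ (x+ex (coeff Q k)) ⟨
    coeff P k + (coeff Q k + e * coeff Q k)
      ≈⟨ solve 3 (λ x y e → x :+ (y :+ e :* y) := (x :+ e :* y) :+ y) refl (coeff P k) (coeff Q k) e ⟩
    (coeff P k + e * coeff Q k) + coeff Q k
      ≈⟨ +-congʳ (trans (+-congˡ (sym (coeff-scale e Q k))) (trans (sym (coeff-⊕ P (scale e Q) k)) (at eq k))) ⟩
    0# + coeff Q k                              ≈⟨ +-identityˡ _ ⟩
    coeff Q k                                   ∎
    where open ≈-Reasoning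

  ⊕-scale≋ : ∀ P L Q M → P ⊕ L ≋ Q ⊕ M → P ⊕ scale e Q ≋ M ⊕ scale e L
  ⊕-scale≋ P L Q M eq = mk≋ λ k → begin
    coeff (P ⊕ scale e Q) k
      ≈⟨ trans (coeff-⊕ P (scale e Q) k) (+-congˡ (coeff-scale e Q k)) ⟩
    coeff P k + e * coeff Q k
      ≈⟨ trans (sym (+-identityʳ _)) (+-congˡ (sym (x+ex (coeff L k)))) ⟩
    (coeff P k + e * coeff Q k) + (coeff L k + e * coeff L k)
      ≈⟨ solve 4 (λ x y l e → (x :+ e :* y) :+ (l :+ e :* l) := (x :+ l) :+ (e :* y :+ e :* l)) refl _ _ _ e ⟩
    (coeff P k + coeff L k) + (e * coeff Q k + e * coeff L k)
      ≈⟨ +-congʳ (trans (sym (coeff-⊕ P L k)) (trans (at eq k) (coeff-⊕ Q M k))) ⟩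
    (coeff Q k + coeff M k) + (e * coeff Q k + e * coeff L k)
      ≈⟨ solve 4 (λ y m l e → (y :+ m) :+ (e :* y :+ e :* l) := (y :+ e :* y) :+ (m :+ e :* l)) refl _ _ _ e ⟩
    (coeff Q k + e * coeff Q k) + (coeff M k + e * coeff L k)
      ≈⟨ trans (+-congʳ (x+ex (coeff Q k))) (+-identityˡ _) ⟩
    coeff M k + e * coeff L k
      ≈⟨ trans (coeff-⊕ M (scale e L) k) (+-congˡ (coeff-scale e L k)) ⟨
    coeff (M ⊕ scale e L) k ∎
    where open ≈-Reasoning

  ⊕-cancelˡ : ∀ {P Q} L M → P ≋ Q → P ⊕ L ≋ Q ⊕ M → L ≋ M
  ⊕-cancelˡ {P} {Q} L M p eq = mk≋ λ k → +-cancelˡ (coeff Q k) _ _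
    (trans (+-congʳ (sym (at p k))) (trans (sym (coeff-⊕ P L k)) (trans (at eq k) (coeff-⊕ Q M k))))

  module _ (h α : ℕ) (α≤h : α ℕ.≤ h) where

    Row : Set c
    Row = List Poly

    Short : Row → Set c
    Short = All (λ P → length P ℕ.≤ α)

    -- ∑_c X^{hc} P_c
    rowPoly : Row → Poly
    rowPoly []       = []
    rowPoly (P ∷ Ps) = P ⊕ shift^ h (rowPoly Ps)

    -- ∑_b (X + e)^{hb} Q_b
    gridPoly : List Row → Poly
    gridPoly []       = []
    gridPoly (r ∷ rs) = rowPoly r ⊕ lin^ e h (gridPoly rs)

    -- The k-th derivative of gridPoly, with X^h replaced by 1 and (X + e)^h by ζ: its degree no longer involves h.
    rowResidue : ℕ → ℕ → ℕ → Row → Poly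
    rowResidue s t k []       = []
    rowResidue s t k (P ∷ Ps) = δ^ s t k P ⊕ rowResidue (h ℕ.+ s) t k Ps

    gridResidue : Carrier → ℕ → ℕ → ℕ → List Row → Poly
    gridResidue ζ s t k []       = []
    gridResidue ζ s t k (r ∷ rs) = rowResidue s t k r ⊕ scale ζ (gridResidue ζ s (h ℕ.+ t) k rs)

    length-rowResidue : ∀ s t k {r} → Short r → length (rowResidue s t k r) ℕ.≤ k ℕ.+ α
    length-rowResidue s t k []               = z≤n
    length-rowResidue s t k (_∷_ {P} l ls) = length-⊕ (δ^ s t k P) _ (length-δ^ s t k P l) (length-rowResidue (h ℕ.+ s) t k ls)

    length-gridResidue : ∀ ζ s t k {rs} → All Short rs → length (gridResidue ζ s t k rs) ℕ.≤ k ℕ.+ α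
    length-gridResidue ζ s t k [] = z≤n
    length-gridResidue ζ s t k {_ ∷ rs} (_∷_ {r} l ls) = length-⊕ (rowResidue s t k r) _ (length-rowResidue s t k l)
      (ℕₚ.≤-trans (ℕₚ.≤-reflexive (length-scale ζ (gridResidue ζ s (h ℕ.+ t) k rs))) (length-gridResidue ζ s (h ℕ.+ t) k ls))

    eval-δ^-[] : ∀ s t k x → eval (δ^ s t k []) x ≈ 0#
    eval-δ^-[] s t k x = trans (eval-cong (δ^ s t k []) _ x (δ^-scale s t k 0# []))
      (trans (eval-scale 0# (δ^ s t k []) x) (zeroˡ _))

    module _ {x ζ} (x^h : x ^ h ≈ 1#) (x+e^h : (x + e) ^ h ≈ ζ) where
      open ≈-Reasoning

      -- Moving X^h out of the operator raises s by h, and X^h has the value 1 at x. The next lemma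
      -- treats (X + e)^h in the same way, with t and the value ζ.
      eval-rowResidue : ∀ s t k r → eval (δ^ s t k (rowPoly r)) x ≈ eval (rowResidue s t k r) x
      eval-rowResidue s t k []       = eval-δ^-[] s t k x
      eval-rowResidue s t k (P ∷ Ps) = begin
        eval (δ^ s t k (P ⊕ shift^ h (rowPoly Ps))) x
          ≈⟨ eval-cong (δ^ s t k (P ⊕ shift^ h (rowPoly Ps))) (δ^ s t k P ⊕ shift^ h (δ^ (h ℕ.+ s) t k (rowPoly Ps))) x
               (≋.trans (δ^-⊕ s t k P (shift^ h (rowPoly Ps))) (⊕-cong (≋.refl {δ^ s t k P}) (δ^-shift^ s t k h (rowPoly Ps)))) ⟩
        eval (δ^ s t k P ⊕ shift^ h (δ^ (h ℕ.+ s) t k (rowPoly Ps))) x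
          ≈⟨ eval-⊕ (δ^ s t k P) _ x ⟩
        eval (δ^ s t k P) x + eval (shift^ h (δ^ (h ℕ.+ s) t k (rowPoly Ps))) x
          ≈⟨ +-congˡ (trans (eval-shift^ h (δ^ (h ℕ.+ s) t k (rowPoly Ps)) x) (trans (*-congʳ x^h) (*-identityˡ _))) ⟩
        eval (δ^ s t k P) x + eval (δ^ (h ℕ.+ s) t k (rowPoly Ps)) x
          ≈⟨ +-congˡ (eval-rowResidue (h ℕ.+ s) t k Ps) ⟩
        eval (δ^ s t k P) x + eval (rowResidue (h ℕ.+ s) t k Ps) x
          ≈⟨ eval-⊕ (δ^ s t k P) _ x ⟨
        eval (rowResidue s t k (P ∷ Ps)) x ∎

      eval-gridResidue : ∀ s t k rs → eval (δ^ s t k (gridPoly rs)) x ≈ eval (gridResidue ζ s t k rs) x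
      eval-gridResidue s t k []       = eval-δ^-[] s t k x
      eval-gridResidue s t k (r ∷ rs) = begin
        eval (δ^ s t k (rowPoly r ⊕ lin^ e h (gridPoly rs))) x
          ≈⟨ eval-cong (δ^ s t k (rowPoly r ⊕ lin^ e h (gridPoly rs))) (δ^ s t k (rowPoly r) ⊕ lin^ e h (δ^ s (h ℕ.+ t) k (gridPoly rs))) x
               (≋.trans (δ^-⊕ s t k (rowPoly r) (lin^ e h (gridPoly rs))) (⊕-cong (≋.refl {δ^ s t k (rowPoly r)}) (δ^-lin^ s t k h (gridPoly rs)))) ⟩
        eval (δ^ s t k (rowPoly r) ⊕ lin^ e h (δ^ s (h ℕ.+ t) k (gridPoly rs))) x
          ≈⟨ eval-⊕ (δ^ s t k (rowPoly r)) _ x ⟩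
        eval (δ^ s t k (rowPoly r)) x + eval (lin^ e h (δ^ s (h ℕ.+ t) k (gridPoly rs))) x
          ≈⟨ +-cong (eval-rowResidue s t k r)
               (trans (eval-lin^ e h (δ^ s (h ℕ.+ t) k (gridPoly rs)) x) (*-cong x+e^h (eval-gridResidue s (h ℕ.+ t) k rs))) ⟩
        eval (rowResidue s t k r) x + ζ * eval (gridResidue ζ s (h ℕ.+ t) k rs) x
          ≈⟨ +-congˡ (eval-scale ζ (gridResidue ζ s (h ℕ.+ t) k rs) x) ⟨
        eval (rowResidue s t k r) x + eval (scale ζ (gridResidue ζ s (h ℕ.+ t) k rs)) x
          ≈⟨ eval-⊕ (rowResidue s t k r) _ x ⟨
        eval (gridResidue ζ s t k (r ∷ rs)) x ∎

    length-rowPoly : ∀ {r} → Short r → length (rowPoly r) ℕ.≤ h ℕ.* length r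
    length-rowPoly [] = z≤n
    length-rowPoly {_ ∷ r} (_∷_ {P} l ls) rewrite ℕₚ.*-suc h (length r) = length-⊕ P _
      (ℕₚ.≤-trans l (ℕₚ.≤-trans α≤h (ℕₚ.m≤m+n h _)))
      (ℕₚ.≤-trans (ℕₚ.≤-reflexive (length-shift^ h (rowPoly r))) (ℕₚ.+-monoʳ-≤ h (length-rowPoly ls)))

    length-gridPoly : ∀ β {rs} → All Short rs → All (λ r → length r ≡ β) rs →
      length (gridPoly rs) ℕ.≤ h ℕ.* length rs ℕ.+ h ℕ.* β
    length-gridPoly β [] [] = z≤n
    length-gridPoly β {_ ∷ rs} (_∷_ {r} l ls) (≡.refl ∷ eqs) rewrite ℕₚ.*-suc h (length rs) = length-⊕ (rowPoly r) _
      (ℕₚ.≤-trans (length-rowPoly l) (ℕₚ.m≤n+m _ _))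
      (ℕₚ.≤-trans (length-lin^ e h (gridPoly rs) (length-gridPoly β ls eqs)) (ℕₚ.≤-reflexive (≡.sym (ℕₚ.+-assoc h _ _))))

    -- What matters for `sparse` is the number α b of exponents that can occur in a row, not its
    -- degree, which may be close to h b.
    exponents : ℕ → List ℕ
    exponents zero    = []
    exponents (suc b) = upTo α ++ map (h ℕ.+_) (exponents b)

    length-exponents : ∀ b → length (exponents b) ≡ α ℕ.* b
    length-exponents zero    = ≡.sym (ℕₚ.*-zeroʳ α)
    length-exponents (suc b) = ≡.trans (length-++ (upTo α)) (≡.trans
      (≡.cong₂ ℕ._+_ (length-upTo α) (≡.trans (length-map (h ℕ.+_) (exponents b)) (length-exponents b)))
      (≡.sym (ℕₚ.*-suc α b)))

    exponents-< : ∀ b → All (ℕ._< h ℕ.* b) (exponents b)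
    exponents-< zero    = []
    exponents-< (suc b) rewrite ℕₚ.*-suc h b = Allₚ.++⁺
      (All.map (λ i<α → ℕₚ.<-≤-trans i<α (ℕₚ.≤-trans α≤h (ℕₚ.m≤m+n h _))) (Allₚ.all-upTo α))
      (Allₚ.map⁺ (All.map (ℕₚ.+-monoʳ-< h) (exponents-< b)))

    coeff-rowPoly-< : ∀ P Ps {k} → k ℕ.< h → coeff (rowPoly (P ∷ Ps)) k ≈ coeff P k
    coeff-rowPoly-< P Ps {k} k<h = trans (coeff-⊕ P _ k) (trans (+-congˡ (coeff-shift^-< h (rowPoly Ps) k<h)) (+-identityʳ _))

    coeff-rowPoly-+ : ∀ P Ps → length P ℕ.≤ α → ∀ k → coeff (rowPoly (P ∷ Ps)) (h ℕ.+ k) ≈ coeff (rowPoly Ps) k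
    coeff-rowPoly-+ P Ps l k = trans (coeff-⊕ P _ (h ℕ.+ k)) (trans
      (+-cong (reflexive (coeff-≥length P (ℕₚ.≤-trans l (ℕₚ.≤-trans α≤h (ℕₚ.m≤m+n h k))))) (coeff-shift^-+ h (rowPoly Ps) k))
      (+-identityˡ _))

    data Split : ℕ → Set where
      low  : ∀ {k} → k ℕ.< h → Split k
      high : ∀ k → Split (h ℕ.+ k)

    split : ∀ k → Split k
    split k with k ℕ.<? h
    ... | yes k<h = low k<h
    ... | no  k≮h = ≡.subst Split (ℕₚ.m+[n∸m]≡n (ℕₚ.≮⇒≥ k≮h)) (high (k ℕ.∸ h))

    support-rowPoly : ∀ {r} → Short r → ∀ j → j ∈ exponents (length r) ⊎ coeff (rowPoly r) j ≈ 0#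
    support-rowPoly [] j = inj₂ refl
    support-rowPoly {_ ∷ Ps} (_∷_ {P} l ls) j with split j
    ... | high k = [ (λ k∈ → inj₁ (∈-++⁺ʳ (upTo α) (∈-map⁺ (h ℕ.+_) k∈)))
                   , (λ z → inj₂ (trans (coeff-rowPoly-+ P Ps l k) z)) ]′ (support-rowPoly ls k)
    ... | low j<h with j ℕ.<? α
    ...   | yes j<α = inj₁ (∈-++⁺ˡ (∈-upTo⁺ j<α))
    ...   | no  j≮α = inj₂ (trans (coeff-rowPoly-< P Ps j<h) (reflexive (coeff-≥length P (ℕₚ.≤-trans l (ℕₚ.≮⇒≥ j≮α)))))

    -- Since α ≤ h, the entries of a row occupy disjoint blocks of exponents, and nothing can cancel
    -- between them.
    rowPoly-injective : ∀ {r r'} → Short r → Short r' → length r ≡ length r' →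
      rowPoly r ≋ rowPoly r' → Pointwise _≋_ r r'
    rowPoly-injective [] [] _ _ = []
    rowPoly-injective {P ∷ Ps} {P' ∷ Ps'} (l ∷ ls) (l' ∷ ls') len eq =
      mk≋ (λ k → first k (split k)) ∷
      rowPoly-injective ls ls' (ℕₚ.suc-injective len) (mk≋ λ k →
        trans (sym (coeff-rowPoly-+ P Ps l k)) (trans (at eq (h ℕ.+ k)) (coeff-rowPoly-+ P' Ps' l' k)))
      where
      first : ∀ k → Split k → coeff P k ≈ coeff P' k
      first k (low k<h) = trans (sym (coeff-rowPoly-< P Ps k<h)) (trans (at eq k) (coeff-rowPoly-< P' Ps' k<h))
      first _ (high k)  = reflexive (≡.trans (coeff-≥length P (far l)) (≡.sym (coeff-≥length P' (far l'))))
        where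
        far : ∀ {n} → n ℕ.≤ α → n ℕ.≤ h ℕ.+ k
        far n≤α = ℕₚ.≤-trans n≤α (ℕₚ.≤-trans α≤h (ℕₚ.m≤m+n h k))

    module _ (β : ℕ) (αβ≤h : α ℕ.* β ℕ.≤ h) (hβ≤p : h ℕ.* β ℕ.≤ p) where

      -- The lowest rows agree because their difference is sparse and divisible by (X + e)^h.
      gridPoly-injective : ∀ {rs rs'} → All Short rs → All Short rs' →
        All (λ r → length r ≡ β) rs → All (λ r → length r ≡ β) rs' → length rs ≡ length rs' →
        gridPoly rs ≋ gridPoly rs' → Pointwise (Pointwise _≋_) rs rs'
      gridPoly-injective [] [] _ _ _ _ = []
      gridPoly-injective {r ∷ rs} {r' ∷ rs'} (l ∷ ls) (l' ∷ ls') (n ∷ ns) (n' ∷ ns') len eq =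
        rowPoly-injective l l' (≡.trans n (≡.sym n')) rows ∷
        gridPoly-injective ls ls' ns ns' (ℕₚ.suc-injective len)
          (lin^-injective e h (⊕-cancelˡ (lin^ e h (gridPoly rs)) (lin^ e h (gridPoly rs')) rows eq))
        where
        difference : rowPoly r ⊕ scale e (rowPoly r') ≋ lin^ e h (gridPoly rs' ⊕ scale e (gridPoly rs))
        difference = ≋.trans (⊕-scale≋ (rowPoly r) (lin^ e h (gridPoly rs)) (rowPoly r') (lin^ e h (gridPoly rs')) eq)
          (≋.sym (≋.trans (lin^-⊕ e h (gridPoly rs') _) (⊕-cong (≋.refl {lin^ e h (gridPoly rs')}) (lin^-scale e h e (gridPoly rs)))))
        support : ∀ j → j ∈ exponents β ⊎ coeff (rowPoly r ⊕ scale e (rowPoly r')) j ≈ 0#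
        support j with support-rowPoly l j | support-rowPoly l' j
        ... | inj₁ j∈ | _       = inj₁ (≡.subst (λ b → j ∈ exponents b) n j∈)
        ... | inj₂ _  | inj₁ j∈ = inj₁ (≡.subst (λ b → j ∈ exponents b) n' j∈)
        ... | inj₂ z  | inj₂ z' = inj₂ (trans (coeff-⊕ (rowPoly r) _ j) (trans
          (+-cong z (trans (coeff-scale e (rowPoly r') j) (trans (*-congˡ z') (zeroʳ e)))) (+-identityˡ 0#)))
        rows : rowPoly r ≋ rowPoly r'
        -- At most α β exponents face a zero of order h at 1, which is the use of `αβ≤h`; `hβ≤p`
        -- keeps the exponents below p.
        rows = ⊕-scale≋[] (rowPoly r) (rowPoly r') (sparse e 1+e (exponents β) h difference
          (ℕₚ.≤-trans (ℕₚ.≤-reflexive (length-exponents β)) αβ≤h)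
          (All.map (λ j< → ℕₚ.<-≤-trans j< hβ≤p) (exponents-< β)) support)

      grid : (Fin (β ℕ.* (β ℕ.* α)) → Fin p) → List Row
      grid w = tabulate {n = β} λ b → tabulate {n = β} λ c → tabulate {n = α} λ j → decode (w (combine b (combine c j)))

      grid-short : ∀ w → All Short (grid w)
      grid-short w = Allₚ.tabulate⁺ {n = β} λ b → Allₚ.tabulate⁺ {n = β} λ c → ℕₚ.≤-reflexive (length-tabulate {n = α} _)

      grid-width : ∀ w → All (λ r → length r ≡ β) (grid w)
      grid-width w = Allₚ.tabulate⁺ {n = β} λ b → length-tabulate {n = β} _

      ≋-tabulate⁻ : ∀ {n} {f g : Fin n → Carrier} → tabulate f ≋ tabulate g → ∀ i → f i ≈ g i
      ≋-tabulate⁻ eq Fin.zero    = at eq 0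
      ≋-tabulate⁻ eq (Fin.suc i) = ≋-tabulate⁻ (mk≋ λ k → at eq (suc k)) i

      grid-injective : ∀ u v → gridPoly (grid u) ≋ gridPoly (grid v) → ∀ i → u i ≡ v i
      grid-injective u v eq i =
        let b , i' , eq₁ = Finₚ.combine-surjective {β} {β ℕ.* α} i
            c , j  , eq₂ = Finₚ.combine-surjective {β} {α} i'
            rows = gridPoly-injective (grid-short u) (grid-short v) (grid-width u) (grid-width v)
                     (≡.trans (length-tabulate {n = β} _) (≡.sym (length-tabulate {n = β} _))) eq
        in ≡.subst (λ i → u i ≡ v i) (≡.trans (≡.cong (combine b) eq₂) eq₁)
             (decode-injective (≋-tabulate⁻ (tabulate⁻ (tabulate⁻ rows b) c) j))

      module _ (n : ℕ) (ζ : Fin n → Carrier) where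

        -- After k < α derivatives a polynomial of length α has length at most k + α, so that 2 α
        -- coefficients suffice for each class and each order k.
        residue : (Fin (β ℕ.* (β ℕ.* α)) → Fin p) → Fin n → Fin α → Fin (α ℕ.+ α) → Fin p
        residue w i k j = encode (coeff (gridResidue (ζ i) 0 0 (toℕ k) (grid w)) (toℕ j))
        residues : (Fin (β ℕ.* (β ℕ.* α)) → Fin p) → Fin (n ℕ.* (α ℕ.* (α ℕ.+ α))) → Fin p
        residues w I =
          let i , I' = remQuot {n} (α ℕ.* (α ℕ.+ α)) I
              k , j  = remQuot {α} (α ℕ.+ α) I'
          in residue w i k j
        residues-combine : ∀ w i k j → residues w (combine i (combine k j)) ≡ residue w i k j
        residues-combine w i k j = ≡.trans
          (≡.cong (λ q → residue w (proj₁ q) (proj₁ (remQuot {α} (α ℕ.+ α) (proj₂ q))) (proj₂ (remQuot {α} (α ℕ.+ α) (proj₂ q))))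
            (Finₚ.remQuot-combine {n} i (combine k j)))
          (≡.cong (λ q → residue w i (proj₁ q) (proj₂ q)) (Finₚ.remQuot-combine {α} k j))

        stepanov : n ℕ.* (α ℕ.* (α ℕ.+ α)) ℕ.< β ℕ.* (β ℕ.* α) → α ℕ.≤ p →
          ∀ xs → AllPairs (λ x y → ¬ x ≈ y) xs →
          All (λ x → ¬ x ≈ 0# × ¬ x + e ≈ 0# × x ^ h ≈ 1# × Σ[ i ∈ Fin n ] (x + e) ^ h ≈ ζ i) xs →
          length xs ℕ.* α ℕ.< h ℕ.* β ℕ.+ h ℕ.* β
        stepanov fewer α≤p xs distinct points with collision 1<p fewer residues
        -- The difference of the two grids vanishes to order α at every point. With 2 h β zeros or
        -- more, counted with multiplicity, it would be the zero polynomial, and injectivity would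
        -- give u = v.
        ... | u , v , u≢v , same = ℕₚ.≰⇒> λ many → u≢v (grid-injective u v (⊕-scale≋[] (gridPoly (grid u)) (gridPoly (grid v))
                (too-many-roots α xs distinct (All.map vanish points) (ℕₚ.≤-trans length-Φ many))))
          where
          Φ = gridPoly (grid u) ⊕ scale e (gridPoly (grid v))
          length-grid : ∀ w → length (gridPoly (grid w)) ℕ.≤ h ℕ.* β ℕ.+ h ℕ.* β
          length-grid w = ≡.subst (λ l → length (gridPoly (grid w)) ℕ.≤ h ℕ.* l ℕ.+ h ℕ.* β)
            (length-tabulate {n = β} _) (length-gridPoly β (grid-short w) (grid-width w))
          length-Φ : length Φ ℕ.≤ h ℕ.* β ℕ.+ h ℕ.* β
          length-Φ = length-⊕ (gridPoly (grid u)) _ (length-grid u)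
            (ℕₚ.≤-trans (ℕₚ.≤-reflexive (length-scale e (gridPoly (grid v)))) (length-grid v))
          same-coeff : ∀ i {k} → k ℕ.< α → ∀ {j} → j ℕ.< α ℕ.+ α →
            coeff (gridResidue (ζ i) 0 0 k (grid u)) j ≈ coeff (gridResidue (ζ i) 0 0 k (grid v)) j
          same-coeff i {k} k<α {j} j<2α
            = ≡.subst₂ (λ k j → coeff (gridResidue (ζ i) 0 0 k (grid u)) j ≈ coeff (gridResidue (ζ i) 0 0 k (grid v)) j)
                (Finₚ.toℕ-fromℕ< k<α) (Finₚ.toℕ-fromℕ< j<2α)
                (encode-injective (≡.trans (≡.sym (residues-combine u i k' j'))
                  (≡.trans (same (combine i (combine k' j'))) (residues-combine v i k' j'))))
            where
            k' = Fin.fromℕ< k<α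
            j' = Fin.fromℕ< j<2α
          same-residue : ∀ i {k} → k ℕ.< α → gridResidue (ζ i) 0 0 k (grid u) ≋ gridResidue (ζ i) 0 0 k (grid v)
          same-residue i {k} k<α = mk≋ λ j → compare j (j ℕ.<? α ℕ.+ α)
            where
            out : ∀ w {j} → ¬ j ℕ.< α ℕ.+ α → coeff (gridResidue (ζ i) 0 0 k (grid w)) j ≡ 0#
            out w j≮ = coeff-≥length (gridResidue (ζ i) 0 0 k (grid w)) (ℕₚ.≤-trans
              (length-gridResidue (ζ i) 0 0 k (grid-short w)) (ℕₚ.≤-trans (ℕₚ.+-monoˡ-≤ α (ℕₚ.<⇒≤ k<α)) (ℕₚ.≮⇒≥ j≮)))
            compare : ∀ j → Dec (j ℕ.< α ℕ.+ α) →
              coeff (gridResidue (ζ i) 0 0 k (grid u)) j ≈ coeff (gridResidue (ζ i) 0 0 k (grid v)) j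
            compare j (yes j<) = same-coeff i k<α j<
            compare j (no  j≮) = reflexive (≡.trans (out u j≮) (≡.sym (out v j≮)))
          vanish : ∀ {x} → ¬ x ≈ 0# × ¬ x + e ≈ 0# × x ^ h ≈ 1# × Σ[ i ∈ Fin n ] (x + e) ^ h ≈ ζ i →
            Σ[ K ∈ Poly ] Φ ≋ lin^ (- x) α K
          vanish {x} (x≉0 , x+e≉0 , x^h , i , x+e^h) = multiplicity (-‿inverseʳ x) x≉0 x+e≉0 α α≤p Φ λ k k<α → begin
            eval (δ^ 0 0 k Φ) x
              ≈⟨ eval-cong (δ^ 0 0 k Φ) _ x (≋.trans (δ^-⊕ 0 0 k (gridPoly (grid u)) _)
                   (⊕-cong (≋.refl {δ^ 0 0 k (gridPoly (grid u))}) (δ^-scale 0 0 k e (gridPoly (grid v))))) ⟩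
            eval (δ^ 0 0 k (gridPoly (grid u)) ⊕ scale e (δ^ 0 0 k (gridPoly (grid v)))) x
              ≈⟨ trans (eval-⊕ (δ^ 0 0 k (gridPoly (grid u))) _ x) (+-congˡ (eval-scale e (δ^ 0 0 k (gridPoly (grid v))) x)) ⟩
            eval (δ^ 0 0 k (gridPoly (grid u))) x + e * eval (δ^ 0 0 k (gridPoly (grid v))) x
              ≈⟨ +-cong
                   (trans (eval-gridResidue x^h x+e^h 0 0 k (grid u))
                     (eval-cong (gridResidue (ζ i) 0 0 k (grid u)) (gridResidue (ζ i) 0 0 k (grid v)) x (same-residue i k<α)))
                   (*-congˡ (eval-gridResidue x^h x+e^h 0 0 k (grid v))) ⟩
            eval (gridResidue (ζ i) 0 0 k (grid v)) x + e * eval (gridResidue (ζ i) 0 0 k (grid v)) x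
              ≈⟨ x+ex _ ⟩
            0# ∎
            where open ≈-Reasoning

-- The field with p elements

module PrimeField (p-1 : ℕ) (p-prime : Prime (suc p-1)) where

  p : ℕ
  p = suc p-1

  1<p : 1 ℕ.< p
  1<p = ℕ.nonTrivial⇒n>1 p {{prime⇒nonTrivial p-prime}}

  infix 4 _≈_
  record _≈_ (x y : ℕ) : Set where
    constructor mk≈
    field %-≡ : x % p ≡ y % p
  open _≈_ public

  ≡⇒≈ : ∀ {x y} → x ≡ y → x ≈ y
  ≡⇒≈ eq = mk≈ (≡.cong (_% p) eq)

  %-≈ : ∀ x → x % p ≈ x
  %-≈ x = mk≈ (m%n%n≡m%n x p)

  <-≈⇒≡ : ∀ {x y} → x ℕ.< p → y ℕ.< p → x ≈ y → x ≡ y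
  <-≈⇒≡ x<p y<p x≈y = ≡.trans (≡.sym (m<n⇒m%n≡m x<p)) (≡.trans (%-≡ x≈y) (m<n⇒m%n≡m y<p))

  +-cong : ∀ {x y u v} → x ≈ y → u ≈ v → x ℕ.+ u ≈ y ℕ.+ v
  +-cong {x} {y} {u} {v} xy uv = mk≈ (≡.trans (%-distribˡ-+ x u p)
    (≡.trans (≡.cong₂ (λ a b → (a ℕ.+ b) % p) (%-≡ xy) (%-≡ uv)) (≡.sym (%-distribˡ-+ y v p))))

  *-cong : ∀ {x y u v} → x ≈ y → u ≈ v → x ℕ.* u ≈ y ℕ.* v
  *-cong {x} {y} {u} {v} xy uv = mk≈ (≡.trans (%-distribˡ-* x u p)
    (≡.trans (≡.cong₂ (λ a b → (a ℕ.* b) % p) (%-≡ xy) (%-≡ uv)) (≡.sym (%-distribˡ-* y v p))))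

  p*≈0 : ∀ x → p ℕ.* x ≈ 0
  p*≈0 x = mk≈ (≡.trans (≡.cong (_% p) (ℕₚ.*-comm p x)) (m*n%n≡0 x p))

  -- Natural numbers up to congruence, with (p - 1) x as the negative of x: the semiring laws are
  -- then inherited from ℕ, and no reduction has to be carried along.
  𝔽 : CommutativeRing 0ℓ 0ℓ
  𝔽 = record
    { Carrier = ℕ ; _≈_ = _≈_ ; _+_ = ℕ._+_ ; _*_ = ℕ._*_ ; -_ = p-1 ℕ.*_ ; 0# = 0 ; 1# = 1
    ; isCommutativeRing = record
      { isRing = record
        { +-isAbelianGroup = record
          { isGroup = record
            { isMonoid = record
              { isSemigroup = record
                { isMagma = record
                  { isEquivalence = record
                    { refl = mk≈ ≡.refl ; sym = λ q → mk≈ (≡.sym (%-≡ q)) ; trans = λ q r → mk≈ (≡.trans (%-≡ q) (%-≡ r)) }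
                  ; ∙-cong = +-cong }
                ; assoc = λ x y z → ≡⇒≈ (ℕₚ.+-assoc x y z) }
              ; identity = (λ x → ≡⇒≈ ≡.refl) , λ x → ≡⇒≈ (ℕₚ.+-identityʳ x) }
            ; inverse = (λ x → mk≈ (≡.trans (≡.cong (_% p) (ℕₚ.+-comm (p-1 ℕ.* x) x)) (%-≡ (p*≈0 x)))) , p*≈0
            ; ⁻¹-cong = λ q → *-cong (≡⇒≈ {p-1} ≡.refl) q }
          ; comm = λ x y → ≡⇒≈ (ℕₚ.+-comm x y) }
        ; *-cong = *-cong
        ; *-assoc = λ x y z → ≡⇒≈ (ℕₚ.*-assoc x y z)
        ; *-identity = (λ x → ≡⇒≈ (ℕₚ.*-identityˡ x)) , λ x → ≡⇒≈ (ℕₚ.*-identityʳ x)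
        ; distrib = (λ x y z → ≡⇒≈ (ℕₚ.*-distribˡ-+ x y z)) , λ x y z → ≡⇒≈ (ℕₚ.*-distribʳ-+ x y z) }
      ; *-comm = λ x y → ≡⇒≈ (ℕₚ.*-comm x y) }
    }
  open CommutativeRing 𝔽 public using (refl; sym; trans; setoid; commutativeSemiring; semiring; ring)

  noZeroDivisors : ∀ {x y} → x ℕ.* y ≈ 0 → x ≈ 0 ⊎ y ≈ 0
  noZeroDivisors {x} {y} xy≈0 = Sum.map
    (λ d → mk≈ (n∣m⇒m%n≡0 x p d)) (λ d → mk≈ (n∣m⇒m%n≡0 y p d))
    (euclidsLemma x y p-prime (m%n≡0⇒n∣m (x ℕ.* y) p (%-≡ xy≈0)))

  ι≡ : ∀ n → Polynomials.ι 𝔽 n ≡ n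
  ι≡ zero    = ≡.refl
  ι≡ (suc n) = ≡.cong suc (ι≡ n)

  open import Algebra.Properties.Semiring.Exp semiring using () renaming (_^_ to _^𝔽_)

  ^𝔽≡^ : ∀ x n → x ^𝔽 n ≡ x ℕ.^ n
  ^𝔽≡^ x zero    = ≡.refl
  ^𝔽≡^ x (suc n) = ≡.cong (x ℕ.*_) (^𝔽≡^ x n)

  module 𝔽-Stepanov = Stepanov 𝔽 noZeroDivisors p
    (λ {m} {n} m<p n<p eq → <-≈⇒≡ m<p n<p (≡.subst₂ _≈_ (ι≡ m) (ι≡ n) eq))
    1<p
    (λ x → fromℕ< (m%n<n x p))
    (λ {x} {y} eq → mk≈ (≡.trans (≡.sym (Finₚ.toℕ-fromℕ< (m%n<n x p))) (≡.trans (≡.cong toℕ eq) (Finₚ.toℕ-fromℕ< (m%n<n y p)))))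
    toℕ
    (λ {i} {j} eq → Finₚ.toℕ-injective (<-≈⇒≡ (Finₚ.toℕ<n i) (Finₚ.toℕ<n j) eq))

  stepanov-bound : ∀ h α β n → α ℕ.≤ h → α ℕ.* β ℕ.≤ h → h ℕ.* β ℕ.≤ p → α ℕ.≤ p →
    n ℕ.* (α ℕ.* (α ℕ.+ α)) ℕ.< β ℕ.* (β ℕ.* α) → (ζ : Fin n → ℕ) →
    ∀ xs → Unique xs →
    All (λ x → x ℕ.< p × x ≢ 0 × x ≢ 1 × x ℕ.^ h ≈ 1 × Σ[ i ∈ Fin n ] (x ℕ.+ p-1) ℕ.^ h ≈ ζ i) xs →
    length xs ℕ.* α ℕ.< h ℕ.* β ℕ.+ h ℕ.* β
  stepanov-bound h α β n α≤h αβ≤h hβ≤p α≤p fewer ζ xs unique points =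
    𝔽-Stepanov.stepanov h α α≤h β αβ≤h hβ≤p n ζ fewer α≤p xs
      (distinct (All.map proj₁ points) unique) (All.map point points)
    where
    distinct : ∀ {xs} → All (ℕ._< p) xs → Unique xs → AllPairs (λ x y → ¬ x ≈ y) xs
    distinct []           []         = []
    distinct (x<p ∷ xs<p) (x∉ ∷ uxs) =
      All.zipWith (λ { (x≢y , y<p) x≈y → x≢y (<-≈⇒≡ x<p y<p x≈y) }) (x∉ , xs<p) ∷ distinct xs<p uxs
    cancel-1 : ∀ {x} → x ℕ.+ p-1 ≈ 0 → x ≈ 1
    cancel-1 {x} eq = trans (trans (≡⇒≈ (≡.sym (ℕₚ.+-identityʳ x)))
      (trans (+-cong (refl {x}) (mk≈ (≡.sym (n%n≡0 p)))) (≡⇒≈ (≡.trans (≡.cong (x ℕ.+_) (ℕₚ.+-comm 1 p-1)) (≡.sym (ℕₚ.+-assoc x p-1 1))))))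
      (+-cong eq (refl {1}))
    point : ∀ {x} → x ℕ.< p × x ≢ 0 × x ≢ 1 × x ℕ.^ h ≈ 1 × Σ[ i ∈ Fin n ] (x ℕ.+ p-1) ℕ.^ h ≈ ζ i →
      ¬ x ≈ 0 × ¬ x ℕ.+ p-1 ℕ.* 1 ≈ 0 × x ^𝔽 h ≈ 1 × Σ[ i ∈ Fin n ] (x ℕ.+ p-1 ℕ.* 1) ^𝔽 h ≈ ζ i
    point {x} (x<p , x≢0 , x≢1 , x^h , i , y^h) rewrite ℕₚ.*-identityʳ p-1 =
      (λ x≈0 → x≢0 (<-≈⇒≡ x<p (s≤s z≤n) x≈0)) ,
      (λ y≈0 → x≢1 (<-≈⇒≡ x<p 1<p (cancel-1 y≈0))) ,
      trans (≡⇒≈ (^𝔽≡^ x h)) x^h , i , trans (≡⇒≈ (^𝔽≡^ (x ℕ.+ p-1) h)) y^h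

open import Data.List using (filter; take; deduplicate; cartesianProduct; cartesianProductWith; concatMap; lookup)
open import Data.Nat using (_+_; _*_; _^_; _≤_; _<_; _≤?_)
open import Data.Nat.Properties
open import Data.Nat.Tactic.RingSolver using (solve-∀)
open import Function using (_∘_; mk⇔)
import Data.List.Relation.Unary.Unique.DecPropositional.Properties as DecUniqueₚ
import Data.List.Relation.Unary.Unique.Propositional.Properties as Uniqueₚ

-- Finite sums, fibres and double counting

module Counting where
  open import Data.Bool using (true; false)
  open import Data.Nat.ListAction using (sum)
  open import Relation.Binary.Definitions using (DecidableEquality)
  open import Relation.Unary using (Decidable; Pred)
  open ≡

  -- A relation replaces the injective map because the code of a collision will be built from
  -- membership proofs, and so is not given as a function of the collision alone.
  length-≤-by : ∀ {a b r} {A : Set a} {B : Set b} (R : A → B → Set r) {xs : List A} {ys : List B} → Unique xs →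
    (∀ {x} → x ∈ xs → Σ[ y ∈ B ] (y ∈ ys × R x y)) →
    (∀ {x x' y} → x ∈ xs → x' ∈ xs → R x y → R x' y → x ≡ x') → length xs ≤ length ys
  length-≤-by R [] _ _ = z≤n
  length-≤-by R {x ∷ xs} {ys} (x∉xs ∷ unique) image injective
    with y , y∈ys , Rxy ← image (here refl)
    with ys₁ , ys₂ , refl ← ∈-∃++ y∈ys =
      subst (suc (length xs) ≤_) (sym (length-++-sucʳ ys₁ y ys₂))
        (s≤s (length-≤-by R unique image' (λ x∈ x'∈ → injective (there x∈) (there x'∈))))
    where
    image' : ∀ {x'} → x' ∈ xs → Σ[ y' ∈ _ ] (y' ∈ ys₁ ++ ys₂ × R x' y')
    image' {x'} x'∈xs with y' , y'∈ , Rx'y' ← image (there x'∈xs) with ∈-++⁻ ys₁ y'∈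
    ... | inj₁ y'∈₁         = y' , ∈-++⁺ˡ y'∈₁ , Rx'y'
    ... | inj₂ (there y'∈₂) = y' , ∈-++⁺ʳ ys₁ y'∈₂ , Rx'y'
    ... | inj₂ (here refl)  = ⊥-elim (All.lookup x∉xs x'∈xs (injective (here refl) (there x'∈xs) Rxy Rx'y'))

  length-⊆ : ∀ {a} {A : Set a} {xs ys : List A} → Unique xs → (∀ {x} → x ∈ xs → x ∈ ys) → length xs ≤ length ys
  length-⊆ unique sub = length-≤-by _≡_ unique (λ x∈ → _ , sub x∈ , refl) λ { _ _ refl refl → refl }

  𝟙 : ∀ {p} {P : Set p} → Dec P → ℕ
  𝟙 (yes _) = 1
  𝟙 (no _)  = 0

  module _ {a} {A : Set a} where

    ∑ : List A → (A → ℕ) → ℕ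
    ∑ xs f = sum (map f xs)

    ∑-mono : ∀ xs {f g} → (∀ {x} → x ∈ xs → f x ≤ g x) → ∑ xs f ≤ ∑ xs g
    ∑-mono []       f≤g = z≤n
    ∑-mono (x ∷ xs) f≤g = +-mono-≤ (f≤g (here refl)) (∑-mono xs (f≤g ∘ there))

    ∑-cong : ∀ xs {f g} → (∀ x → f x ≡ g x) → ∑ xs f ≡ ∑ xs g
    ∑-cong []       eq = refl
    ∑-cong (x ∷ xs) eq = cong₂ _+_ (eq x) (∑-cong xs eq)

    ∑-+ : ∀ xs f g → ∑ xs (λ x → f x + g x) ≡ ∑ xs f + ∑ xs g
    ∑-+ []       f g = refl
    ∑-+ (x ∷ xs) f g = trans (cong (f x + g x +_) (∑-+ xs f g)) (lemma (f x) (g x) _ _)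
      where
      lemma : ∀ a b c d → a + b + (c + d) ≡ a + c + (b + d)
      lemma = solve-∀

    ∑-*ʳ : ∀ xs f c → ∑ xs (λ x → f x * c) ≡ ∑ xs f * c
    ∑-*ʳ []       f c = refl
    ∑-*ʳ (x ∷ xs) f c = trans (cong (f x * c +_) (∑-*ʳ xs f c)) (sym (*-distribʳ-+ c (f x) _))

    ∑-const : ∀ xs c → ∑ xs (λ _ → c) ≡ length xs * c
    ∑-const []       c = refl
    ∑-const (x ∷ xs) c = cong (c +_) (∑-const xs c)

    ∑-𝟙 : ∀ {p} {P : Pred A p} (P? : Decidable P) xs → ∑ xs (λ x → 𝟙 (P? x)) ≡ length (filter P? xs)
    ∑-𝟙 P? []       = refl
    ∑-𝟙 P? (x ∷ xs) with P? x
    ... | yes _ = cong suc (∑-𝟙 P? xs)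
    ... | no  _ = ∑-𝟙 P? xs

  length-concatMap : ∀ {a b} {A : Set a} {B : Set b} (f : A → List B) xs → length (concatMap f xs) ≡ ∑ xs (length ∘ f)
  length-concatMap f []       = refl
  length-concatMap f (x ∷ xs) = trans (length-++ (f x)) (cong (length (f x) +_) (length-concatMap f xs))

  length-cartesianProductWith : ∀ {a b c} {A : Set a} {B : Set b} {C : Set c} (f : A → B → C) xs ys →
    length (cartesianProductWith f xs ys) ≡ length xs * length ys
  length-cartesianProductWith f []       ys = refl
  length-cartesianProductWith f (x ∷ xs) ys = trans (length-++ (map (f x) ys))
    (cong₂ _+_ (length-map (f x) ys) (length-cartesianProductWith f xs ys))

  length-filter-map : ∀ {a b p} {A : Set a} {B : Set b} {P : Pred B p} (P? : Decidable P) (f : A → B) xs →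
    length (filter P? (map f xs)) ≡ length (filter (P? ∘ f) xs)
  length-filter-map P? f []       = refl
  length-filter-map P? f (x ∷ xs) with does (P? (f x))
  ... | true  = cong suc (length-filter-map P? f xs)
  ... | false = length-filter-map P? f xs

  length-filter-filter : ∀ {a p q} {A : Set a} {P : Pred A p} {Q : Pred A q} (P? : Decidable P) (Q? : Decidable Q) xs →
    length (filter P? (filter Q? xs)) ≤ length (filter P? xs)
  length-filter-filter P? Q? []       = z≤n
  length-filter-filter P? Q? (x ∷ xs) with does (Q? x)
  ... | true with does (P? x)
  ...   | true  = s≤s (length-filter-filter P? Q? xs)
  ...   | false = length-filter-filter P? Q? xs
  length-filter-filter P? Q? (x ∷ xs) | false with does (P? x)
  ...   | true  = m≤n⇒m≤1+n (length-filter-filter P? Q? xs)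
  ...   | false = length-filter-filter P? Q? xs

  length-filter-cartesianProduct : ∀ {a b p} {A : Set a} {B : Set b} {P : Pred (A × B) p} (P? : Decidable P) xs ys →
    length (filter P? (cartesianProduct xs ys)) ≡ ∑ xs (λ x → length (filter (λ y → P? (x , y)) ys))
  length-filter-cartesianProduct P? []       ys = refl
  length-filter-cartesianProduct P? (x ∷ xs) ys = begin
    length (filter P? (map (x ,_) ys ++ cartesianProduct xs ys))
      ≡⟨ cong length (filter-++ P? (map (x ,_) ys) _) ⟩
    length (filter P? (map (x ,_) ys) ++ filter P? (cartesianProduct xs ys))
      ≡⟨ length-++ (filter P? (map (x ,_) ys)) ⟩
    length (filter P? (map (x ,_) ys)) + length (filter P? (cartesianProduct xs ys))
      ≡⟨ cong₂ _+_ (length-filter-map P? (x ,_) ys) (length-filter-cartesianProduct P? xs ys) ⟩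
    length (filter (λ y → P? (x , y)) ys) + ∑ xs (λ x → length (filter (λ y → P? (x , y)) ys)) ∎
    where open ≡-Reasoning

  module Fibres {a b} {A : Set a} {B : Set b} (_≟_ : DecidableEquality B) (f : A → B) where

    fibre : B → List A → List A
    fibre z = filter (λ x → f x ≟ z)

    length-fibre-∷ : ∀ z x xs → length (fibre z (x ∷ xs)) ≡ 𝟙 (f x ≟ z) + length (fibre z xs)
    length-fibre-∷ z x xs with f x ≟ z
    ... | yes _ = refl
    ... | no  _ = refl

    ∑-delta-∉ : ∀ z zs (g : B → ℕ) → All (z ≢_) zs → ∑ zs (λ w → 𝟙 (z ≟ w) * g w) ≡ 0
    ∑-delta-∉ z []       g []        = refl
    ∑-delta-∉ z (w ∷ zs) g (z≢w ∷ z≢) with z ≟ w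
    ... | yes z≡w = ⊥-elim (z≢w z≡w)
    ... | no  _   = ∑-delta-∉ z zs g z≢

    ∑-delta : ∀ {z zs} (g : B → ℕ) → Unique zs → z ∈ zs → ∑ zs (λ w → 𝟙 (z ≟ w) * g w) ≡ g z
    ∑-delta {z} {w ∷ zs} g (w≢ ∷ unique) z∈ with z ≟ w | z∈
    ... | yes refl | _          = trans (cong (1 * g z +_) (∑-delta-∉ z zs g w≢)) (trans (+-identityʳ _) (*-identityˡ _))
    ... | no z≢w   | here z≡w   = ⊥-elim (z≢w z≡w)
    ... | no _     | there z∈zs = ∑-delta g unique z∈zs

    ∑-fibres : ∀ {zs} (g : B → ℕ) → Unique zs → ∀ xs → (∀ {x} → x ∈ xs → f x ∈ zs) →
      ∑ xs (g ∘ f) ≡ ∑ zs (λ z → length (fibre z xs) * g z)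
    ∑-fibres {zs} g unique []       _     = sym (trans (∑-const zs 0) (*-zeroʳ (length zs)))
    ∑-fibres {zs} g unique (x ∷ xs) image = begin
      g (f x) + ∑ xs (g ∘ f)
        ≡⟨ cong₂ _+_ (sym (∑-delta g unique (image (here refl)))) (∑-fibres g unique xs (image ∘ there)) ⟩
      ∑ zs (λ z → 𝟙 (f x ≟ z) * g z) + ∑ zs (λ z → length (fibre z xs) * g z)
        ≡⟨ ∑-+ zs _ _ ⟨
      ∑ zs (λ z → 𝟙 (f x ≟ z) * g z + length (fibre z xs) * g z)
        ≡⟨ ∑-cong zs (λ z → trans (cong (_* g z) (length-fibre-∷ z x xs)) (*-distribʳ-+ (g z) (𝟙 (f x ≟ z)) _)) ⟨
      ∑ zs (λ z → length (fibre z (x ∷ xs)) * g z) ∎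
      where open ≡-Reasoning

    length-fibres : ∀ {zs} → Unique zs → ∀ xs → (∀ {x} → x ∈ xs → f x ∈ zs) →
      length xs ≡ ∑ zs (λ z → length (fibre z xs))
    length-fibres {zs} unique xs image = begin
      length xs                              ≡⟨ *-identityʳ _ ⟨
      length xs * 1                          ≡⟨ ∑-const xs 1 ⟨
      ∑ xs (λ _ → 1)                         ≡⟨ ∑-fibres (λ _ → 1) unique xs image ⟩
      ∑ zs (λ z → length (fibre z xs) * 1)   ≡⟨ ∑-cong zs (λ z → *-identityʳ _) ⟩
      ∑ zs (λ z → length (fibre z xs))       ∎
      where open ≡-Reasoning

    2ab≤a²+b² : ∀ a b → 2 * (a * b) ≤ a * a + b * b
    2ab≤a²+b² a b with ≤-total a b
    ... | inj₁ a≤b with d , refl ← m≤n⇒∃[o]m+o≡n a≤b = subst (2 * (a * (a + d)) ≤_) (sym (expand a d)) (m≤m+n _ _)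
      where
      expand : ∀ a d → a * a + (a + d) * (a + d) ≡ 2 * (a * (a + d)) + d * d
      expand = solve-∀
    2ab≤a²+b² a b | inj₂ b≤a with d , refl ← m≤n⇒∃[o]m+o≡n b≤a = subst (2 * ((b + d) * b) ≤_) (sym (expand b d)) (m≤m+n _ _)
      where
      expand : ∀ b d → (b + d) * (b + d) + b * b ≡ 2 * ((b + d) * b) + d * d
      expand = solve-∀

    -- Cauchy–Schwarz, in the form ∑ 2 K c_z ≤ ∑ (K² + c_z²) with c_z the size of the fibre over z.
    few-collisions : ∀ K .{{_ : NonZero K}} {zs} → Unique zs → ∀ xs → (∀ {x} → x ∈ xs → f x ∈ zs) →
      ∑ xs (λ x → length (fibre (f x) xs)) ≤ K * length xs → length xs ≤ K * length zs
    few-collisions K {zs} unique xs image collisions = *-cancelˡ-≤ K (+-cancelʳ-≤ (K * L) _ _ (begin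
      K * L + K * L                                       ≡⟨ double K L ⟩
      L * (2 * K)                                         ≡⟨ cong (_* (2 * K)) (length-fibres unique xs image) ⟩
      ∑ zs c * (2 * K)                                    ≡⟨ ∑-*ʳ zs c (2 * K) ⟨
      ∑ zs (λ z → c z * (2 * K))                          ≤⟨ ∑-mono zs (λ {z} _ → ≤-trans (≤-reflexive (flip-2 (c z) K)) (2ab≤a²+b² K (c z))) ⟩
      ∑ zs (λ z → K * K + c z * c z)                      ≡⟨ ∑-+ zs _ _ ⟩
      ∑ zs (λ _ → K * K) + ∑ zs (λ z → c z * c z)         ≡⟨ cong₂ _+_ (∑-const zs (K * K)) (sym (∑-fibres c unique xs image)) ⟩
      length zs * (K * K) + ∑ xs (c ∘ f)                  ≤⟨ +-monoʳ-≤ _ collisions ⟩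
      length zs * (K * K) + K * L                         ≡⟨ cong (_+ K * L) (regroup (length zs) K) ⟩
      K * (K * length zs) + K * L                         ∎))
      where
      open ≤-Reasoning
      L = length xs
      c : B → ℕ
      c z = length (fibre z xs)
      double : ∀ K L → K * L + K * L ≡ L * (2 * K)
      double = solve-∀
      flip-2 : ∀ c K → c * (2 * K) ≡ 2 * (K * c)
      flip-2 = solve-∀
      regroup : ∀ z K → z * (K * K) ≡ K * (K * z)
      regroup = solve-∀

    -- An entry in a fibre with fewer than r elements contributes at most r². The larger fibres lie
    -- over at most n values, hence contain at most n m entries, each contributing at most m².
    second-moment : ∀ n r m xs → (∀ z → length (fibre z xs) ≤ m) →
      (∀ zs → Unique zs → length zs ≡ n → ¬ All (λ z → r ≤ length (fibre z xs)) zs) →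
      ∑ xs (λ x → length (fibre (f x) xs) * length (fibre (f x) xs)) ≤ length xs * (r * r) + n * m * (m * m)
    second-moment n r m xs all≤m few-large = begin
      ∑ xs (λ x → c x * c x)                                      ≤⟨ ∑-mono xs (λ {x} _ → pointwise x) ⟩
      ∑ xs (λ x → r * r + 𝟙 (r ≤? c x) * (m * m))                 ≡⟨ ∑-+ xs _ _ ⟩
      ∑ xs (λ _ → r * r) + ∑ xs (λ x → 𝟙 (r ≤? c x) * (m * m))
        ≡⟨ cong₂ _+_ (∑-const xs (r * r)) (trans (∑-*ʳ xs (λ x → 𝟙 (r ≤? c x)) (m * m)) (cong (_* (m * m)) (∑-𝟙 (λ x → r ≤? c x) xs))) ⟩
      length xs * (r * r) + length large * (m * m)                ≤⟨ +-monoʳ-≤ (length xs * (r * r)) (*-monoˡ-≤ (m * m) large≤) ⟩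
      length xs * (r * r) + n * m * (m * m)                       ∎
      where
      open ≤-Reasoning
      c : A → ℕ
      c x = length (fibre (f x) xs)
      pointwise : ∀ x → c x * c x ≤ r * r + 𝟙 (r ≤? c x) * (m * m)
      pointwise x with r ≤? c x
      ... | yes _  = ≤-trans (*-mono-≤ (all≤m (f x)) (all≤m (f x))) (≤-trans (≤-reflexive (sym (*-identityˡ (m * m)))) (m≤n+m _ (r * r)))
      ... | no r≰c = ≤-trans (*-mono-≤ (<⇒≤ (≰⇒> r≰c)) (<⇒≤ (≰⇒> r≰c))) (m≤m+n _ _)
      large = filter (λ x → r ≤? c x) xs
      values = deduplicate _≟_ (map f large)
      values-unique : Unique values
      values-unique = DecUniqueₚ.deduplicate-! _≟_ (map f large)
      values-large : ∀ {z} → z ∈ values → r ≤ length (fibre z xs)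
      values-large z∈ with x , x∈ , refl ← ∈-map⁻ f (∈-deduplicate⁻ _≟_ (map f large) z∈) = proj₂ (∈-filter⁻ (λ x → r ≤? c x) {xs = xs} x∈)
      values≤n : length values ≤ n
      values≤n = ≮⇒≥ λ n<values → few-large (take n values) (Uniqueₚ.take⁺ n values-unique)
        (trans (length-take n values) (m≤n⇒m⊓n≡m (<⇒≤ n<values)))
        (All.tabulate λ z∈ → values-large (take-⊆ n values z∈))
        where
        take-⊆ : ∀ n (zs : List B) {z} → z ∈ take n zs → z ∈ zs
        take-⊆ (suc n) (z ∷ zs) (here eq)   = here eq
        take-⊆ (suc n) (z ∷ zs) (there z∈)  = there (take-⊆ n zs z∈)
      large≤ : length large ≤ n * m
      large≤ = begin
        length large                            ≡⟨ length-fibres values-unique large (λ x∈ → ∈-deduplicate⁺ _≟_ (∈-map⁺ f x∈)) ⟩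
        ∑ values (λ z → length (fibre z large)) ≤⟨ ∑-mono values (λ {z} _ → ≤-trans (length-filter-filter (λ x → f x ≟ z) (λ x → r ≤? c x) xs) (all≤m z)) ⟩
        ∑ values (λ _ → m)                      ≡⟨ ∑-const values m ⟩
        length values * m                       ≤⟨ *-monoˡ-≤ m values≤n ⟩
        n * m                                   ∎

open Counting
open import Data.List.Membership.Propositional.Properties.WithK using (unique∧set⇒bag)
open import Data.List.Relation.Binary.BagAndSetEquality using (∼bag⇒↭)
open import Data.Nat.ListAction using (product)
open import Data.Nat.ListAction.Properties using (product-↭)
open import Relation.Nullary.Decidable using (¬?)
open import Defs

unique-map : ∀ {a b} {A : Set a} {B : Set b} (f : A → B) {xs} →
  (∀ {x y} → x ∈ xs → y ∈ xs → f x ≡ f y → x ≡ y) → Unique xs → Unique (map f xs)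
unique-map f {[]}     inj []           = []
unique-map f {x ∷ xs} inj (x∉ ∷ unique) =
  All.tabulate (λ z∈ fx≡z → case-map z∈ fx≡z) ∷ unique-map f (λ x∈ y∈ → inj (there x∈) (there y∈)) unique
  where
  case-map : ∀ {z} → z ∈ map f xs → f x ≢ z
  case-map z∈ fx≡z with y , y∈ , ≡.refl ← ∈-map⁻ f z∈ = All.lookup x∉ y∈ (inj (here ≡.refl) (there y∈) fx≡z)

^-distribʳ-* : ∀ n x y → (x * y) ^ n ≡ x ^ n * y ^ n
^-distribʳ-* zero    x y = ≡.refl
^-distribʳ-* (suc n) x y = ≡.trans (≡.cong (x * y *_) (^-distribʳ-* n x y)) (regroup x y (x ^ n) (y ^ n))
  where
  regroup : ∀ x y a b → x * y * (a * b) ≡ x * a * (y * b)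
  regroup = solve-∀

-- Multiplicative subgroups and collisions of Heisenberg products

module Subgroup (p-1 : ℕ) (p-prime : Prime (suc p-1)) (A : List ℕ) (isSubgroup : IsMultSubgroup (suc p-1) A) where
  open PrimeField p-1 p-prime
  open IsMultSubgroup isSubgroup
  open import Relation.Binary.Reasoning.Setoid setoid
  open import Algebra.Solver.Ring.NaturalCoefficients.Default commutativeSemiring
    using (solve; _:=_; _:+_; _:*_; con)

  h : ℕ
  h = length A

  <p : ∀ {a} → a ∈ A → a < p
  <p a∈ = proj₂ (All.lookup inFpStar a∈)

  ≈⇒≡ : ∀ {a b} → a ∈ A → b ∈ A → a ≈ b → a ≡ b
  ≈⇒≡ a∈ b∈ = <-≈⇒≡ (<p a∈) (<p b∈)

  ≢0 : ∀ {a} → a ∈ A → a ≢ 0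
  ≢0 a∈ ≡.refl with () ← proj₁ (All.lookup inFpStar a∈)

  ≉0 : ∀ {a} → a ∈ A → ¬ a ≈ 0
  ≉0 a∈ a≈0 = ≢0 a∈ (<-≈⇒≡ (<p a∈) (s≤s z≤n) a≈0)

  x+ex : ∀ x → x + p-1 * x ≈ 0
  x+ex = p*≈0

  +-cancel : ∀ {x y} z → x + z ≈ y + z → x ≈ y
  +-cancel {x} {y} z eq = begin
    x                     ≈⟨ ≡⇒≈ (+-identityʳ x) ⟨
    x + 0                 ≈⟨ +-cong (refl {x}) (x+ex z) ⟨
    x + (z + p-1 * z)     ≈⟨ ≡⇒≈ (+-assoc x z _) ⟨
    x + z + p-1 * z       ≈⟨ +-cong eq (refl {p-1 * z}) ⟩
    y + z + p-1 * z       ≈⟨ ≡⇒≈ (+-assoc y z _) ⟩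
    y + (z + p-1 * z)     ≈⟨ +-cong (refl {y}) (x+ex z) ⟩
    y + 0                 ≈⟨ ≡⇒≈ (+-identityʳ y) ⟩
    y                     ∎

  *-cancel : ∀ {x y z} → ¬ z ≈ 0 → x * z ≈ y * z → x ≈ y
  *-cancel {x} {y} {z} z≉0 eq with noZeroDivisors {x + p-1 * y} {z} (begin
    (x + p-1 * y) * z       ≈⟨ ≡⇒≈ (≡.trans (*-distribʳ-+ z x _) (≡.cong (x * z +_) (*-assoc p-1 y z))) ⟩
    x * z + p-1 * (y * z)   ≈⟨ +-cong eq (refl {p-1 * (y * z)}) ⟩
    y * z + p-1 * (y * z)   ≈⟨ x+ex (y * z) ⟩
    0                       ∎)
  ... | inj₁ x-y≈0 = +-cancel (p-1 * y) (trans x-y≈0 (sym (x+ex y)))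
  ... | inj₂ z≈0   = ⊥-elim (z≉0 z≈0)

  divide : ∀ {a b} → a ∈ A → b ∈ A → Σ[ c ∈ ℕ ] (c ∈ A × b ≈ c * a)
  divide {a} {b} a∈ b∈ with a⁻¹ , a⁻¹∈ , aa⁻¹ ← invClosed a∈ = (b * a⁻¹) % p , mulClosed b∈ a⁻¹∈ , (begin
    b                     ≈⟨ ≡⇒≈ (*-identityʳ b) ⟨
    b * 1                 ≈⟨ *-cong (refl {b}) (trans (sym (≡⇒≈ aa⁻¹)) (%-≈ (a * a⁻¹))) ⟩
    b * (a * a⁻¹)         ≈⟨ ≡⇒≈ (≡.trans (≡.cong (b *_) (*-comm a a⁻¹)) (≡.sym (*-assoc b a⁻¹ a))) ⟩
    b * a⁻¹ * a           ≈⟨ *-cong (%-≈ (b * a⁻¹)) (refl {a}) ⟨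
    (b * a⁻¹) % p * a     ∎)

  -- Multiplication by a permutes A, so a^h ∏A = ∏A.
  lagrange : ∀ {a} → a ∈ A → a ^ h ≈ 1
  lagrange {a} a∈ = *-cancel (product≉0 A (λ x∈ → x∈)) (begin
    a ^ h * product A       ≈⟨ product-map A ⟨
    product (map mul A)     ≈⟨ ≡⇒≈ (product-↭ (∼bag⇒↭ (unique∧set⇒bag mul-unique unique (mk⇔ to from)))) ⟩
    product A               ≈⟨ ≡⇒≈ (*-identityˡ _) ⟨
    1 * product A           ∎)
    where
    mul : ℕ → ℕ
    mul x = (a * x) % p
    product≉0 : ∀ xs → (∀ {x} → x ∈ xs → x ∈ A) → ¬ product xs ≈ 0
    product≉0 []       _   1≈0 with () ← <-≈⇒≡ 1<p (s≤s z≤n) 1≈0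
    product≉0 (x ∷ xs) xs⊆A z with noZeroDivisors {x} z
    ... | inj₁ x≈0 = ≉0 (xs⊆A (here ≡.refl)) x≈0
    ... | inj₂ w   = product≉0 xs (xs⊆A ∘ there) w
    product-map : ∀ xs → product (map mul xs) ≈ a ^ length xs * product xs
    product-map []       = refl
    product-map (x ∷ xs) = begin
      mul x * product (map mul xs)                ≈⟨ *-cong (%-≈ (a * x)) (product-map xs) ⟩
      (a * x) * (a ^ length xs * product xs)
        ≈⟨ solve 4 (λ a x b c → (a :* x) :* (b :* c) := (a :* b) :* (x :* c)) refl a x (a ^ length xs) (product xs) ⟩
      a ^ suc (length xs) * product (x ∷ xs)      ∎
    mul-unique : Unique (map mul A)
    mul-unique = unique-map mul (λ {x} {y} x∈ y∈ eq → ≈⇒≡ x∈ y∈ (*-cancel (≉0 a∈)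
      (trans (≡⇒≈ (*-comm x a)) (trans (mk≈ eq) (≡⇒≈ (*-comm a y)))))) unique
    to : ∀ {x} → x ∈ map mul A → x ∈ A
    to x∈ with y , y∈ , ≡.refl ← ∈-map⁻ mul x∈ = mulClosed a∈ y∈
    from : ∀ {x} → x ∈ A → x ∈ map mul A
    from {x} x∈ with c , c∈ , x≈ca ← divide a∈ x∈ = ≡.subst (_∈ map mul A)
      (≈⇒≡ (mulClosed a∈ c∈) x∈ (trans (%-≈ (a * c)) (trans (≡⇒≈ (*-comm a c)) (sym x≈ca)))) (∈-map⁺ mul c∈)

  A₁ : List ℕ
  A₁ = filter (λ t → ¬? (t ≟ 1)) A

  A₁⊆A : ∀ {t} → t ∈ A₁ → t ∈ A
  A₁⊆A t∈ = proj₁ (∈-filter⁻ (λ t → ¬? (t ≟ 1)) t∈)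

  A₁-≢1 : ∀ {t} → t ∈ A₁ → t ≢ 1
  A₁-≢1 t∈ = proj₂ (∈-filter⁻ (λ t → ¬? (t ≟ 1)) {xs = A} t∈)

  A₁-unique : Unique A₁
  A₁-unique = Uniqueₚ.filter⁺ (λ t → ¬? (t ≟ 1)) unique

  -- (u - 1)^h, which depends only on the coset of u - 1
  coset : ℕ → ℕ
  coset u = ((u + p-1) ^ h) % p

  open Fibres _≟_ coset public

  -- For u ≠ 1 it contains the ratio x' / X' of every solution of (u - 1) x = x' - X' in A.
  ratios : ℕ → List ℕ
  ratios u with u ≟ 1
  ... | yes _ = A
  ... | no  _ = fibre (coset u) A₁

  ratios-≢1 : ∀ {u} → u ≢ 1 → ratios u ≡ fibre (coset u) A₁
  ratios-≢1 {u} u≢1 with u ≟ 1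
  ... | yes u≡1 = ⊥-elim (u≢1 u≡1)
  ... | no  _   = ≡.refl

  ^-cong-≈ : ∀ {x y} n → x ≈ y → x ^ n ≈ y ^ n
  ^-cong-≈ zero    eq = refl
  ^-cong-≈ (suc n) eq = *-cong eq (^-cong-≈ n eq)

  -- Raising the equation to the power h removes x and y, whose h-th powers are 1 by `lagrange`.
  coset-cong : ∀ {t u x y} → x ∈ A → y ∈ A → (t + p-1) * y ≈ (u + p-1) * x → coset t ≡ coset u
  coset-cong {t} {u} {x} {y} x∈ y∈ eq = %-≡ (begin
    (t + p-1) ^ h             ≈⟨ ≡⇒≈ (*-identityʳ _) ⟨
    (t + p-1) ^ h * 1         ≈⟨ *-cong (refl {(t + p-1) ^ h}) (lagrange y∈) ⟨
    (t + p-1) ^ h * y ^ h     ≈⟨ ≡⇒≈ (^-distribʳ-* h (t + p-1) y) ⟨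
    ((t + p-1) * y) ^ h       ≈⟨ ^-cong-≈ h eq ⟩
    ((u + p-1) * x) ^ h       ≈⟨ ≡⇒≈ (^-distribʳ-* h (u + p-1) x) ⟩
    (u + p-1) ^ h * x ^ h     ≈⟨ *-cong (refl {(u + p-1) ^ h}) (lagrange x∈) ⟩
    (u + p-1) ^ h * 1         ≈⟨ ≡⇒≈ (*-identityʳ _) ⟩
    (u + p-1) ^ h             ∎)

  difference : ∀ {u x x' X'} → x + x' ≈ u * x + X' → x' + p-1 * X' ≈ (u + p-1) * x
  difference {u} {x} {x'} {X'} eq = begin
    x' + p-1 * X'                              ≈⟨ +-cong (x+ex x) (refl {x' + p-1 * X'}) ⟨
    (x + p-1 * x) + (x' + p-1 * X')
      ≈⟨ solve 4 (λ x x' X e → (x :+ e :* x) :+ (x' :+ e :* X) := (x :+ x') :+ (e :* x :+ e :* X)) refl x x' X' p-1 ⟩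
    (x + x') + (p-1 * x + p-1 * X')            ≈⟨ +-cong eq (refl {p-1 * x + p-1 * X'}) ⟩
    (u * x + X') + (p-1 * x + p-1 * X')
      ≈⟨ solve 4 (λ x u X e → (u :* x :+ X) :+ (e :* x :+ e :* X) := (X :+ e :* X) :+ (u :+ e) :* x) refl x u X' p-1 ⟩
    (X' + p-1 * X') + (u + p-1) * x            ≈⟨ +-cong (x+ex X') (refl {(u + p-1) * x}) ⟩
    (u + p-1) * x                              ∎

  -- Two numbers determine a solution of x + x' = u x + X'. For u = 1 the equation says x' = X', and
  -- (x, x') is enough. For u ≠ 1 the pair (X', t) is enough: x' is t X', and then x is (x' - X') /
  -- (u - 1).
  data Code (u : ℕ) : ℕ × ℕ × ℕ → ℕ × ℕ → Set where
    trivial    : ∀ {x x' X'} → u ≡ 1 → Code u (x , x' , X') (x , x')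
    nontrivial : ∀ {x x' X' t} → u ≢ 1 → x' ≈ t * X' → Code u (x , x' , X') (X' , t)

  encode : ∀ {u x x' X'} → u ∈ A → x ∈ A → x' ∈ A → X' ∈ A → x + x' ≈ u * x + X' →
    Σ[ c ∈ ℕ × ℕ ] (c ∈ cartesianProduct A (ratios u) × Code u (x , x' , X') c)
  encode {u} {x} {x'} {X'} u∈ x∈ x'∈ X'∈ eq with u ≟ 1
  ... | yes u≡1 = (x , x') , ∈-cartesianProduct⁺ x∈ x'∈ , trivial u≡1
  ... | no  u≢1 with t , t∈ , x'≈tX' ← divide X'∈ x'∈ = (X' , t) , ∈-cartesianProduct⁺ X'∈ t∈ratios , nontrivial u≢1 x'≈tX'
    where
    scaled : (t + p-1) * X' ≈ (u + p-1) * x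
    scaled = begin
      (t + p-1) * X'       ≈⟨ ≡⇒≈ (*-distribʳ-+ X' t p-1) ⟩
      t * X' + p-1 * X'    ≈⟨ +-cong x'≈tX' (refl {p-1 * X'}) ⟨
      x' + p-1 * X'        ≈⟨ difference {u} {x} eq ⟩
      (u + p-1) * x        ∎
    -- For t = 1 one would have x' = X', hence u x = x and u = 1.
    t≢1 : t ≢ 1
    t≢1 ≡.refl = u≢1 (≈⇒≡ u∈ hasOne (*-cancel (≉0 x∈) (+-cancel x' (begin
      u * x + x'           ≈⟨ +-cong (refl {u * x}) (trans x'≈tX' (≡⇒≈ (*-identityˡ X'))) ⟩
      u * x + X'           ≈⟨ eq ⟨
      x + x'               ≈⟨ ≡⇒≈ (≡.cong (_+ x') (≡.sym (*-identityˡ x))) ⟩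
      1 * x + x'           ∎))))
    t∈ratios : t ∈ fibre (coset u) A₁
    t∈ratios = ∈-filter⁺ (λ t → coset t ≟ coset u) (∈-filter⁺ (λ t → ¬? (t ≟ 1)) t∈ t≢1) (coset-cong x∈ X'∈ scaled)

  shifted≉0 : ∀ {u} → u ∈ A → u ≢ 1 → ¬ u + p-1 ≈ 0
  shifted≉0 u∈ u≢1 z = u≢1 (≈⇒≡ u∈ hasOne (+-cancel p-1 (trans z (mk≈ (≡.sym (n%n≡0 p))))))

  decode : ∀ {u x x' X' y y' Y' c} → u ∈ A → x ∈ A → x' ∈ A → X' ∈ A → y ∈ A → y' ∈ A → Y' ∈ A →
    x + x' ≈ u * x + X' → y + y' ≈ u * y + Y' → Code u (x , x' , X') c → Code u (y , y' , Y') c →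
    (x ≡ y) × (x' ≡ y') × (X' ≡ Y')
  decode {_} {x} {x'} {X'} {Y' = Y'} u∈ x∈ x'∈ X'∈ y∈ y'∈ Y'∈ eq eq' (trivial ≡.refl) (trivial _) =
    ≡.refl , ≡.refl , ≈⇒≡ X'∈ Y'∈ (trans (sym (same X' eq)) (same Y' eq'))
    where
    same : ∀ W → x + x' ≈ 1 * x + W → x' ≈ W
    same W eq = +-cancel x (begin
      x' + x      ≈⟨ ≡⇒≈ (+-comm x' x) ⟩
      x + x'      ≈⟨ eq ⟩
      1 * x + W   ≈⟨ ≡⇒≈ (≡.trans (≡.cong (_+ W) (*-identityˡ x)) (+-comm x W)) ⟩
      W + x       ∎)
  decode _ _ _ _ _ _ _ _ _ (trivial u≡1) (nontrivial u≢1 _) = ⊥-elim (u≢1 u≡1)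
  decode _ _ _ _ _ _ _ _ _ (nontrivial u≢1 _) (trivial u≡1) = ⊥-elim (u≢1 u≡1)
  decode {u} {x} {x'} {X'} {y} u∈ x∈ x'∈ X'∈ y∈ y'∈ Y'∈ eq eq' (nontrivial u≢1 x'≈) (nontrivial _ y'≈)
    with ≡.refl ← ≈⇒≡ x'∈ y'∈ (trans x'≈ (sym y'≈)) =
    ≈⇒≡ x∈ y∈ (*-cancel (shifted≉0 u∈ u≢1) (begin
      x * (u + p-1)     ≈⟨ ≡⇒≈ (*-comm x _) ⟩
      (u + p-1) * x     ≈⟨ difference {u} {x} eq ⟨
      x' + p-1 * X'     ≈⟨ difference {u} {y} eq' ⟩
      (u + p-1) * y     ≈⟨ ≡⇒≈ (*-comm y _) ⟨
      y * (u + p-1)     ∎)) , ≡.refl , ≡.refl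

  Point : Set
  Point = (ℕ × ℕ) × (ℕ × ℕ)

  points : List Point
  points = cartesianProduct (cartesianProduct A A) (cartesianProduct A A)

  heis : Point → Heis
  heis ((x , y) , (x' , y')) = hmul p (x , y , 0) (x' , y' , 0)

  module Products = Fibres Heis-≟ heis

  collides : (pq : Point × Point) → Dec (heis (proj₂ pq) ≡ heis (proj₁ pq))
  collides (P , Q) = Heis-≟ (heis Q) (heis P)

  codesOf : ℕ → List (ℕ × (ℕ × ℕ) × (ℕ × ℕ))
  codesOf u = map (u ,_) (cartesianProduct (cartesianProduct A (ratios u)) (cartesianProduct A (ratios u)))

  -- Listing 1 apart from the other elements of A isolates the term T(1)² = h² of the sum.
  codes : List (ℕ × (ℕ × ℕ) × (ℕ × ℕ))
  codes = concatMap codesOf (1 ∷ A₁)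

  -- The equation between second coordinates is rearranged into the shape of the first, with (Y', Y,
  -- y) in the role of (x, x', X'), so that `Code` serves for both.
  Represents : Point × Point → ℕ × (ℕ × ℕ) × (ℕ × ℕ) → Set
  Represents (((x , y) , (x' , y')) , ((X , Y) , (X' , Y'))) (u , c , d) =
    u ∈ A × (X ≈ u * x) × (y' ≈ u * Y') × (x + x' ≈ u * x + X') × (Y' + Y ≈ u * Y' + y) ×
    Code u (x , x' , X') c × Code u (Y' , Y , y) d

  ∈-points : ∀ {x y x' y'} → ((x , y) , (x' , y')) ∈ points → x ∈ A × y ∈ A × x' ∈ A × y' ∈ A
  ∈-points P∈ with a , b ← ∈-cartesianProduct⁻ (cartesianProduct A A) (cartesianProduct A A) P∈
    with x∈ , y∈ ← ∈-cartesianProduct⁻ A A a | x'∈ , y'∈ ← ∈-cartesianProduct⁻ A A b = x∈ , y∈ , x'∈ , y'∈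

  ∈-1∷A₁ : ∀ {u} → u ∈ A → u ∈ 1 ∷ A₁
  ∈-1∷A₁ {u} u∈ with u ≟ 1
  ... | yes u≡1 = here u≡1
  ... | no  u≢1 = there (∈-filter⁺ (λ t → ¬? (t ≟ 1)) u∈ u≢1)

  collisions : List (Point × Point)
  collisions = filter collides (cartesianProduct points points)

  represent : ∀ {PQ} → PQ ∈ collisions → Σ[ c ∈ ℕ × (ℕ × ℕ) × (ℕ × ℕ) ] (c ∈ codes × Represents PQ c)
  represent {((x , y) , (x' , y')) , ((X , Y) , (X' , Y'))} PQ∈
    with PQ∈₁ , eq ← ∈-filter⁻ collides {xs = cartesianProduct points points} PQ∈
    with P∈ , Q∈ ← ∈-cartesianProduct⁻ points points PQ∈₁
    with x∈ , y∈ , x'∈ , y'∈ ← ∈-points P∈ | X∈ , Y∈ , X'∈ , Y'∈ ← ∈-points Q∈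
    with u , u∈ , X≈ux ← divide x∈ X∈ =
      let c , c∈ , code  = encode u∈ x∈ x'∈ X'∈ eq₁
          d , d∈ , code' = encode u∈ Y'∈ Y∈ y∈ eq₂
      in (u , c , d)
       , ∈-concatMap⁺ codesOf (Any.map (λ { ≡.refl → ∈-map⁺ (u ,_) (∈-cartesianProduct⁺ c∈ d∈) }) (∈-1∷A₁ u∈))
       , u∈ , X≈ux , y'≈uY' , eq₁ , eq₂ , code , code'
    where
    y'≈uY' : y' ≈ u * Y'
    y'≈uY' = *-cancel (≉0 x∈) (begin
      y' * x         ≈⟨ ≡⇒≈ (*-comm y' x) ⟩
      x * y'         ≈⟨ mk≈ (≡.cong (proj₂ ∘ proj₂) eq) ⟨
      X * Y'         ≈⟨ *-cong X≈ux (refl {Y'}) ⟩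
      u * x * Y'     ≈⟨ solve 3 (λ u x y → u :* x :* y := u :* y :* x) refl u x Y' ⟩
      u * Y' * x     ∎)
    eq₁ : x + x' ≈ u * x + X'
    eq₁ = trans (mk≈ (≡.sym (≡.cong proj₁ eq))) (+-cong X≈ux (refl {X'}))
    eq₂ : Y' + Y ≈ u * Y' + y
    eq₂ = begin
      Y' + Y         ≈⟨ ≡⇒≈ (+-comm Y' Y) ⟩
      Y + Y'         ≈⟨ mk≈ (≡.cong (proj₁ ∘ proj₂) eq) ⟩
      y + y'         ≈⟨ +-cong (refl {y}) y'≈uY' ⟩
      y + u * Y'     ≈⟨ ≡⇒≈ (+-comm y _) ⟩
      u * Y' + y     ∎

  -- `decode`, applied to both coordinates, recovers six of the eight entries; the other two are X =
  -- u x and y' = u Y'.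
  represents-injective : ∀ {PQ PQ' c} → PQ ∈ collisions → PQ' ∈ collisions → Represents PQ c → Represents PQ' c → PQ ≡ PQ'
  represents-injective {((x , y) , (x' , y')) , ((X , Y) , (X' , Y'))} {((z , w) , (z' , w')) , ((Z , W) , (Z' , W'))} PQ∈ PQ'∈
    (u∈ , X≈ , y'≈ , e₁ , e₂ , c₁ , c₂) (_ , Z≈ , w'≈ , e₁' , e₂' , c₁' , c₂')
    with P∈ , Q∈ ← ∈-cartesianProduct⁻ points points (proj₁ (∈-filter⁻ collides PQ∈))
       | P'∈ , Q'∈ ← ∈-cartesianProduct⁻ points points (proj₁ (∈-filter⁻ collides PQ'∈))
    with x∈ , y∈ , x'∈ , y'∈ ← ∈-points P∈ | X∈ , Y∈ , X'∈ , Y'∈ ← ∈-points Q∈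
       | z∈ , w∈ , z'∈ , w'∈ ← ∈-points P'∈ | Z∈ , W∈ , Z'∈ , W'∈ ← ∈-points Q'∈
    with ≡.refl , ≡.refl , ≡.refl ← decode u∈ x∈ x'∈ X'∈ z∈ z'∈ Z'∈ e₁ e₁' c₁ c₁'
       | ≡.refl , ≡.refl , ≡.refl ← decode u∈ Y'∈ Y∈ y∈ W'∈ W∈ w∈ e₂ e₂' c₂ c₂'
    with ≡.refl ← ≈⇒≡ X∈ Z∈ (trans X≈ (sym Z≈)) | ≡.refl ← ≈⇒≡ y'∈ w'∈ (trans y'≈ (sym w'≈)) = ≡.refl

  points-unique : Unique points
  points-unique = Uniqueₚ.cartesianProduct⁺ (Uniqueₚ.cartesianProduct⁺ unique unique) (Uniqueₚ.cartesianProduct⁺ unique unique)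

  length-points : length points ≡ (h * h) * (h * h)
  length-points = ≡.trans (length-cartesianProductWith _,_ (cartesianProduct A A) (cartesianProduct A A))
    (≡.cong₂ _*_ (length-cartesianProductWith _,_ A A) (length-cartesianProductWith _,_ A A))

  energy : ∑ points (λ P → length (Products.fibre (heis P) points)) ≤
    h * h * (h * h + ∑ A₁ (λ u → length (fibre (coset u) A₁) * length (fibre (coset u) A₁)))
  energy = ≤R.begin
    ∑ points (λ P → length (Products.fibre (heis P) points))
      ≤R.≡⟨ length-filter-cartesianProduct collides points points ⟨
    length collisions
      ≤R.≤⟨ length-≤-by Represents (Uniqueₚ.filter⁺ collides (Uniqueₚ.cartesianProduct⁺ points-unique points-unique))
              represent represents-injective ⟩
    length codes
      ≤R.≡⟨ length-concatMap codesOf (1 ∷ A₁) ⟩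
    ∑ (1 ∷ A₁) (λ u → length (codesOf u))
      ≤R.≡⟨ ∑-cong (1 ∷ A₁) code-count ⟩
    ∑ (1 ∷ A₁) (λ u → length (ratios u) * length (ratios u) * (h * h))
      ≤R.≡⟨ ∑-*ʳ (1 ∷ A₁) (λ u → length (ratios u) * length (ratios u)) (h * h) ⟩
    (h * h + ∑ A₁ (λ u → length (ratios u) * length (ratios u))) * (h * h)
      ≤R.≡⟨ *-comm _ (h * h) ⟩
    h * h * (h * h + ∑ A₁ (λ u → length (ratios u) * length (ratios u)))
      ≤R.≤⟨ *-monoʳ-≤ (h * h) (+-monoʳ-≤ (h * h) (∑-mono A₁ λ u∈ → ≤-reflexive (≡.cong (λ xs → length xs * length xs) (ratios-≢1 (A₁-≢1 u∈))))) ⟩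
    h * h * (h * h + ∑ A₁ (λ u → length (fibre (coset u) A₁) * length (fibre (coset u) A₁))) ≤R.∎
    where
    module ≤R = ≤-Reasoning
    code-count : ∀ u → length (codesOf u) ≡
      length (ratios u) * length (ratios u) * (h * h)
    code-count u = ≡.trans (length-map (u ,_) (cartesianProduct (cartesianProduct A (ratios u)) (cartesianProduct A (ratios u)))) (≡.trans (length-cartesianProductWith _,_ (cartesianProduct A (ratios u)) (cartesianProduct A (ratios u)))
      (≡.trans (≡.cong₂ _*_ (length-cartesianProductWith _,_ A (ratios u)) (length-cartesianProductWith _,_ A (ratios u)))
        (regroup h (length (ratios u)))))
      where
      regroup : ∀ h r → h * r * (h * r) ≡ r * r * (h * h)
      regroup = solve-∀

  S : List Heis
  S = prodSet p (AA0 A) (AA0 A)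

  product-set-bound : ∀ K .{{_ : NonZero K}} →
    h * h * (h * h + ∑ A₁ (λ u → length (fibre (coset u) A₁) * length (fibre (coset u) A₁))) ≤ K * ((h * h) * (h * h)) →
    (h * h) * (h * h) ≤ K * length S
  product-set-bound K bound = ≡.subst (_≤ K * length S) length-points
    (Products.few-collisions K (DecUniqueₚ.deduplicate-! Heis-≟ _) points heis∈S
      (≤-trans energy (≤-trans bound (≤-reflexive (≡.cong (K *_) (≡.sym length-points))))))
    where
    ∈-AA0 : ∀ {x y} → x ∈ A → y ∈ A → (x , y , 0) ∈ AA0 A
    ∈-AA0 x∈ y∈ = ∈-deduplicate⁺ Heis-≟ (∈-cartesianProductWith⁺ _ x∈ y∈)
    heis∈S : ∀ {P} → P ∈ points → heis P ∈ S
    heis∈S P∈ with x∈ , y∈ , x'∈ , y'∈ ← ∈-points P∈ =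
      ∈-deduplicate⁺ Heis-≟ (∈-cartesianProductWith⁺ (hmul p) (∈-AA0 x∈ y∈) (∈-AA0 x'∈ y'∈))

open import Data.List.Membership.DecPropositional _≟_ using (_∈?_)
import Data.List.Relation.Unary.Any.Properties as Anyₚ
open ≡ using (refl; sym; trans; cong; cong₂; subst)

-- Parameters a = q^3 and b = q^5, with a^5 = b^3 equal to h up to a constant

module LargeSubgroup (p-1 : ℕ) (p-prime : Prime (suc p-1)) (A : List ℕ) (isSubgroup : IsMultSubgroup (suc p-1) A)
  (a b κ c : ℕ) (c≡ : c ≡ 1 + (κ * κ + κ * κ * κ)) (1≤a : 1 ≤ a) (1≤b : 1 ≤ b) (b≤a² : b ≤ a * a) (a⁵≡b³ : a * a * a * a * a ≡ b * b * b)
  (2b³≤h : 2 * (b * b * b) ≤ length A) (4h≤κb³ : 4 * length A ≤ κ * (b * b * b))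
  (2ha²≤p : length A * (2 * (a * a)) ≤ suc p-1) where
  open PrimeField p-1 p-prime using (p; _≈_; mk≈; stepanov-bound)
  open Subgroup p-1 p-prime A isSubgroup
  open IsMultSubgroup isSubgroup
  open ≤-Reasoning

  b³≤h : b * b * b ≤ h
  b³≤h = ≤-trans (m≤n*m (b * b * b) 2) 2b³≤h

  h≤p : h ≤ p
  h≤p = ≤-trans (m≤m*n h (2 * (a * a)) {{ℕ.>-nonZero (≤-trans (*-mono-≤ 1≤a 1≤a) (m≤n*m (a * a) 2))}}) 2ha²≤p

  2hb≤p : h * (2 * b) ≤ p
  2hb≤p = ≤-trans (*-monoʳ-≤ h (*-monoʳ-≤ 2 b≤a²)) 2ha²≤p

  strict-double : ∀ {x y z} → 1 ≤ z → x ≡ 2 * z → y ≡ 4 * z → x < y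
  strict-double {z = suc z} _ refl refl = *-monoˡ-< (suc z) {2} {4} (s≤s (s≤s (s≤s z≤n)))

  A₁-point : ∀ {n x} {ζ : Fin n → ℕ} → x ∈ A₁ → (i : Fin n) → coset x ≡ ζ i →
    x < p × x ≢ 0 × x ≢ 1 × (x ^ h ≈ 1) × Σ[ i ∈ Fin n ] ((x + p-1) ^ h ≈ ζ i)
  A₁-point {x = x} x∈ i eq = <p (A₁⊆A x∈) , ≢0 (A₁⊆A x∈) , A₁-≢1 x∈ , lagrange (A₁⊆A x∈)
    , i , mk≈ (trans (sym (m%n%n≡m%n ((x + p-1) ^ h) p)) (cong (_% p) eq))

  -- Stepanov's bound with n = 1, α = b² and β = 2 b. Here α β = 2 b³ ≤ h, the 2 b⁴ conditions are
  -- fewer than the 4 b⁴ coefficients, and a class has fewer than 4 h / b ≤ κ b² elements.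
  fibre-bound : ∀ z → length (fibre z A₁) ≤ κ * (b * b)
  fibre-bound z = <⇒≤ (*-cancelʳ-< (b * b) _ _ (<-≤-trans
    (stepanov-bound h (b * b) (2 * b) 1 b²≤h (≤-trans (≤-reflexive (e₁ b)) 2b³≤h) 2hb≤p (≤-trans b²≤h h≤p)
      (strict-double (*-mono-≤ (*-mono-≤ 1≤b 1≤b) (*-mono-≤ 1≤b 1≤b)) (e₂ b) (e₃ b)) (λ _ → z)
      (fibre z A₁) (Uniqueₚ.filter⁺ _ A₁-unique)
      (All.tabulate λ x∈ → let x∈A₁ , eq = ∈-filter⁻ (λ x → coset x ≟ z) x∈ in A₁-point x∈A₁ Fin.zero eq))
    (begin
      h * (2 * b) + h * (2 * b)   ≡⟨ e₄ h b ⟩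
      4 * h * b                   ≤⟨ *-monoˡ-≤ b 4h≤κb³ ⟩
      κ * (b * b * b) * b         ≡⟨ e₅ κ b ⟩
      κ * (b * b) * (b * b)       ∎)))
    where
    e₁ : ∀ b → b * b * (2 * b) ≡ 2 * (b * b * b)
    e₁ = solve-∀
    e₂ : ∀ b → 1 * (b * b * (b * b + b * b)) ≡ 2 * (b * b * (b * b))
    e₂ = solve-∀
    e₃ : ∀ b → 2 * b * (2 * b * (b * b)) ≡ 4 * (b * b * (b * b))
    e₃ = solve-∀
    e₄ : ∀ h b → h * (2 * b) + h * (2 * b) ≡ 4 * h * b
    e₄ = solve-∀
    e₅ : ∀ κ b → κ * (b * b * b) * b ≡ κ * (b * b) * (b * b)
    e₅ = solve-∀
    b²≤h : b * b ≤ h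
    b²≤h = ≤-trans (m≤m*n (b * b) b {{ℕ.>-nonZero 1≤b}}) b³≤h

  -- Stepanov's bound with n = a, α = a³ and β = 2 a². Here α β = 2 a⁵ = 2 b³ ≤ h, and the 2 a⁷
  -- conditions are fewer than the 4 a⁷ coefficients. So a classes have together fewer than 4 h / a
  -- ≤ κ a⁴ elements, while a classes of size κ a³ would have at least that many.
  few-large-fibres : ∀ zs → Unique zs → length zs ≡ a → ¬ All (λ z → κ * (a * a * a) ≤ length (fibre z A₁)) zs
  few-large-fibres zs unique-zs refl large = <-irrefl refl (<-≤-trans
    (stepanov-bound h (a' * a' * a') (2 * (a' * a')) a' a³≤h (≤-trans (≤-reflexive (e₁ a')) (≤-trans (≤-reflexive (cong (2 *_) a⁵≡b³)) 2b³≤h))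
      2ha²≤p (≤-trans a³≤h h≤p) (strict-double (*-mono-≤ (*-mono-≤ a³≥1 1≤a) a³≥1) (e₂ a') (e₃ a')) (lookup zs)
      xs (Uniqueₚ.filter⁺ (λ x → coset x ∈? zs) A₁-unique)
      (All.tabulate λ x∈ → let x∈A₁ , z∈ = ∈-filter⁻ (λ x → coset x ∈? zs) x∈
                           in A₁-point x∈A₁ (Any.index z∈) (Anyₚ.lookup-index z∈)))
    (begin
      h * (2 * (a' * a')) + h * (2 * (a' * a'))   ≡⟨ e₄ h a' ⟩
      4 * h * (a' * a')                           ≤⟨ *-monoˡ-≤ (a' * a') 4h≤κb³ ⟩
      κ * (b * b * b) * (a' * a')                 ≡⟨ cong (λ t → κ * t * (a' * a')) a⁵≡b³ ⟨
      κ * (a' * a' * a' * a' * a') * (a' * a')    ≡⟨ e₅ κ a' ⟩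
      a' * (κ * (a' * a' * a')) * (a' * a' * a')  ≤⟨ *-monoˡ-≤ (a' * a' * a') many ⟩
      length xs * (a' * a' * a')                  ∎))
    where
    a' = length zs
    xs = filter (λ x → coset x ∈? zs) A₁
    e₁ : ∀ a → a * a * a * (2 * (a * a)) ≡ 2 * (a * a * a * a * a)
    e₁ = solve-∀
    e₂ : ∀ a → a * (a * a * a * (a * a * a + a * a * a)) ≡ 2 * (a * a * a * a * (a * a * a))
    e₂ = solve-∀
    e₃ : ∀ a → 2 * (a * a) * (2 * (a * a) * (a * a * a)) ≡ 4 * (a * a * a * a * (a * a * a))
    e₃ = solve-∀
    e₄ : ∀ h a → h * (2 * (a * a)) + h * (2 * (a * a)) ≡ 4 * h * (a * a)
    e₄ = solve-∀
    e₅ : ∀ κ a → κ * (a * a * a * a * a) * (a * a) ≡ a * (κ * (a * a * a)) * (a * a * a)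
    e₅ = solve-∀
    a³≥1 : 1 ≤ a' * a' * a'
    a³≥1 = *-mono-≤ (*-mono-≤ 1≤a 1≤a) 1≤a
    a³≤h : a' * a' * a' ≤ h
    a³≤h = ≤-trans (≤-trans (m≤m*n (a' * a' * a') (a' * a') {{ℕ.>-nonZero (*-mono-≤ 1≤a 1≤a)}})
      (≤-reflexive (trans (sym (*-assoc (a' * a' * a') a' a')) a⁵≡b³))) b³≤h
    fibre-kept : ∀ {z} → z ∈ zs → length (fibre z A₁) ≤ length (fibre z xs)
    fibre-kept {z} z∈ = length-⊆ (Uniqueₚ.filter⁺ (λ x → coset x ≟ z) A₁-unique) λ x∈ →
      let x∈A₁ , eq = ∈-filter⁻ (λ x → coset x ≟ z) {xs = A₁} x∈
      in ∈-filter⁺ (λ x → coset x ≟ z) {xs = xs} (∈-filter⁺ (λ x → coset x ∈? zs) x∈A₁ (subst (_∈ zs) (sym eq) z∈)) eq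
    many : a' * (κ * (a' * a' * a')) ≤ length xs
    many = begin
      a' * (κ * (a' * a' * a'))             ≡⟨ ∑-const zs (κ * (a' * a' * a')) ⟨
      ∑ zs (λ _ → κ * (a' * a' * a'))       ≤⟨ ∑-mono zs (λ z∈ → ≤-trans (All.lookup large z∈) (fibre-kept z∈)) ⟩
      ∑ zs (λ z → length (fibre z xs))      ≡⟨ length-fibres unique-zs xs (λ x∈ → proj₂ (∈-filter⁻ (λ x → coset x ∈? zs) {xs = A₁} x∈)) ⟨
      length xs                             ∎

  -- The relation a⁵ = b³ balances the second moment: the small classes give h (κ a³)² = κ² a (h a⁵)
  -- and the large ones a (κ b²)³ = κ³ a b⁶, each at most a h² times its power of κ. Together with
  -- the term h² from u = 1 this makes c = 1 + κ² + κ³.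
  fourth-power-bound : (h * h) * (h * h) ≤ c * a * length S
  fourth-power-bound = product-set-bound (c * a) {{m*n≢0 c a {{subst NonZero (sym c≡) _}} {{ℕ.>-nonZero 1≤a}}}} (begin
    h * h * (h * h + ∑ A₁ (λ u → length (fibre (coset u) A₁) * length (fibre (coset u) A₁)))
      ≤⟨ *-monoʳ-≤ (h * h) (+-monoʳ-≤ (h * h) (second-moment a (κ * (a * a * a)) (κ * (b * b)) A₁ fibre-bound few-large-fibres)) ⟩
    h * h * (h * h + (length A₁ * (κ * (a * a * a) * (κ * (a * a * a))) + a * (κ * (b * b)) * (κ * (b * b) * (κ * (b * b)))))
      ≤⟨ *-monoʳ-≤ (h * h) (+-monoʳ-≤ (h * h) (+-monoˡ-≤ _ (*-monoˡ-≤ _ (length-filter _ A)))) ⟩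
    h * h * (h * h + (h * (κ * (a * a * a) * (κ * (a * a * a))) + a * (κ * (b * b)) * (κ * (b * b) * (κ * (b * b)))))
      ≡⟨ cong (h * h *_) (e₁ h κ a b) ⟩
    h * h * (h * h + (κ * κ * a * (h * (a * a * a * a * a)) + κ * κ * κ * a * ((b * b * b) * (b * b * b))))
      ≤⟨ *-monoʳ-≤ (h * h) (+-mono-≤ (m≤n*m (h * h) a {{ℕ.>-nonZero 1≤a}}) (+-mono-≤
           (*-monoʳ-≤ (κ * κ * a) (*-monoʳ-≤ h (≤-trans (≤-reflexive a⁵≡b³) b³≤h))) (*-monoʳ-≤ (κ * κ * κ * a) (*-mono-≤ b³≤h b³≤h)))) ⟩
    h * h * (a * (h * h) + (κ * κ * a * (h * h) + κ * κ * κ * a * (h * h)))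
      ≡⟨ trans (e₂ h κ a) (cong (λ c → c * a * ((h * h) * (h * h))) (sym c≡)) ⟩
    c * a * ((h * h) * (h * h)) ∎)
    where
    e₁ : ∀ h κ a b → h * h + (h * (κ * (a * a * a) * (κ * (a * a * a))) + a * (κ * (b * b)) * (κ * (b * b) * (κ * (b * b))))
       ≡ h * h + (κ * κ * a * (h * (a * a * a * a * a)) + κ * κ * κ * a * ((b * b * b) * (b * b * b)))
    e₁ = solve-∀
    e₂ : ∀ h κ a → h * h * (a * (h * h) + (κ * κ * a * (h * h) + κ * κ * κ * a * (h * h)))
       ≡ (1 + (κ * κ + κ * κ * κ)) * a * ((h * h) * (h * h))
    e₂ = solve-∀

  instance
    h-nonZero : NonZero h
    h-nonZero = ℕ.>-nonZero (≤-trans (*-mono-≤ (*-mono-≤ 1≤b 1≤b) 1≤b) b³≤h)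

  -- The fifth power replaces the factor a by a⁵ ≤ h, and one h cancels. This is the exponent 19/10
  -- in terms of h².
  nineteenth-power-bound : h ^ 19 ≤ (c * length S) ^ 5
  nineteenth-power-bound = *-cancelˡ-≤ h (begin
    h ^ 20                                    ≡⟨ ^-*-assoc h 4 5 ⟨
    (h ^ 4) ^ 5                               ≡⟨ cong (_^ 5) (e₁ h) ⟩
    ((h * h) * (h * h)) ^ 5                   ≤⟨ ^-monoˡ-≤ 5 fourth-power-bound ⟩
    (c * a * length S) ^ 5                    ≡⟨ cong (_^ 5) (e₂ c a (length S)) ⟩
    (a * (c * length S)) ^ 5                  ≡⟨ ^-distribʳ-* 5 a (c * length S) ⟩
    a ^ 5 * (c * length S) ^ 5                ≤⟨ *-monoˡ-≤ _ (≤-trans (≤-reflexive (trans (e₃ a) a⁵≡b³)) b³≤h) ⟩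
    h * (c * length S) ^ 5                    ∎)
    where
    e₁ : ∀ h → h * (h * (h * (h * 1))) ≡ (h * h) * (h * h)
    e₁ = solve-∀
    e₂ : ∀ c a s → c * a * s ≡ a * (c * s)
    e₂ = solve-∀
    e₃ : ∀ a → a * (a * (a * (a * (a * 1)))) ≡ a * a * a * a * a
    e₃ = solve-∀

  final-bound : h ^ 302 ≤ c ^ 80 * length S ^ 80
  final-bound = begin
    -- The sixteenth power of the preceding bound has h^304 on the left, while |[A,A,0]|^151 calls
    -- only for h^302.
    h ^ 302                     ≤⟨ ^-monoʳ-≤ h (≤ᵇ⇒≤ 302 304 _) ⟩
    h ^ (19 * 16)               ≡⟨ ^-*-assoc h 19 16 ⟨
    (h ^ 19) ^ 16               ≤⟨ ^-monoˡ-≤ 16 nineteenth-power-bound ⟩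
    ((c * length S) ^ 5) ^ 16   ≡⟨ ^-*-assoc (c * length S) 5 16 ⟩
    (c * length S) ^ 80         ≡⟨ ^-distribʳ-* 80 c (length S) ⟩
    c ^ 80 * length S ^ 80      ∎

-- Integer roots and the lower bound for p

power-bracket : ∀ m k .{{_ : NonZero m}} .{{_ : NonZero k}} h → Σ[ q ∈ ℕ ] m * q ^ k ≤ h × h < m * suc q ^ k
power-bracket m (suc k) zero = 0 , ≤-reflexive (*-zeroʳ m) , ≤-trans (ℕ.>-nonZero⁻¹ m) (m≤m*n m (1 ^ suc k) {{m^n≢0 1 (suc k)}})
power-bracket m k (suc h) with q , ≤h , h< ← power-bracket m k h with m * suc q ^ k ≤? suc h
-- Raising h by one raises q by at most one, because h + 1 ≤ m (q + 1)^k < m (q + 2)^k.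
... | yes ≤sh = suc q , ≤sh , <-≤-trans (s≤s h<) (*-monoʳ-< m (^-monoˡ-< k (n<1+n (suc q))))
... | no  ≰sh = q , m≤n⇒m≤1+n ≤h , ≰⇒> ≰sh

∑-∋ : ∀ {a} {A : Set a} {x : A} {xs} (f : A → ℕ) → x ∈ xs → f x ≤ ∑ xs f
∑-∋ f (here refl) = m≤m+n _ _
∑-∋ f (there x∈)  = ≤-trans (∑-∋ f x∈) (m≤n+m _ _)

-- Only the last term n^6 / 6! of the partial sum is kept; `fallingFrom 6 0` is 6! = 720.
sixth-term : ∀ n p → expPartialScaled n 1 6 ≤ p * (1 ^ 6 * fallingFrom 6 0) → n ^ 6 ≤ p * 720
sixth-term n p = ≤-trans (≤-trans (≤-reflexive (sym (trans (*-identityʳ (n ^ 6 * 1)) (*-identityʳ (n ^ 6)))))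
  (∑-∋ {xs = upTo 7} (λ k → n ^ k * 1 ^ (6 ℕ.∸ k) * fallingFrom 6 k) (∈-upTo⁺ {7} {6} ≤-refl)))

^-+³ : ∀ q k → q ^ k * q ^ k * q ^ k ≡ q ^ (k + k + k)
^-+³ q k = sym (trans (^-distribˡ-+-* q (k + k) k) (cong (_* q ^ k) (^-distribˡ-+-* q k k)))

^-+⁵ : ∀ q k → q ^ k * q ^ k * q ^ k * q ^ k * q ^ k ≡ q ^ (k + k + k + k + k)
^-+⁵ q k = sym (trans (^-distribˡ-+-* q (k + k + k + k) k) (cong (_* q ^ k)
  (trans (^-distribˡ-+-* q (k + k + k) k) (cong (_* q ^ k) (sym (^-+³ q k))))))

-- If p were smaller, the term k = 6 of exp (q⁴), for q⁴ < h / √p, would already exceed p.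
large-prime : ∀ {h p q κ} → LeSqrtTimesLn h p → 1440 * κ < q → 2 * q ^ 15 ≤ h → 4 * h ≤ κ * q ^ 15 →
  h * (2 * (q ^ 3 * q ^ 3)) ≤ p
large-prime {h} {p} {q} {κ} hyp κ<q 2q¹⁵≤h 4h≤κq¹⁵ = ≮⇒≥ λ p<B → <-irrefl refl (begin-strict
  q ^ 22                                ≤⟨ ^-monoʳ-≤ q (≤ᵇ⇒≤ 22 24 _) ⟩
  q ^ 24                                ≤⟨ m≤n*m (q ^ 24) 4 ⟩
  4 * q ^ 24                            ≡⟨ cong (4 *_) (^-*-assoc q 4 6) ⟨
  4 * (q ^ 4) ^ 6                       ≤⟨ *-monoʳ-≤ 4 (sixth-term (q ^ 4) p (hyp (q ^ 4) 1 6 ≤-refl (small p<B))) ⟩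
  4 * (p * 720)                         ≤⟨ *-monoʳ-≤ 4 (*-monoˡ-≤ 720 (<⇒≤ p<B)) ⟩
  4 * (h * (2 * (q ^ 3 * q ^ 3)) * 720) ≡⟨ e₁ h (q ^ 3 * q ^ 3) ⟩
  4 * h * (1440 * (q ^ 3 * q ^ 3))      ≤⟨ *-monoˡ-≤ _ 4h≤κq¹⁵ ⟩
  κ * q ^ 15 * (1440 * (q ^ 3 * q ^ 3)) ≡⟨ e₂ κ (q ^ 15) (q ^ 3 * q ^ 3) ⟩
  1440 * κ * (q ^ 15 * (q ^ 3 * q ^ 3)) ≡⟨ cong (λ t → 1440 * κ * t) (trans (cong (q ^ 15 *_) (sym (^-distribˡ-+-* q 3 3))) (sym (^-distribˡ-+-* q 15 6))) ⟩
  -- The assumption p < 2 h q^6 makes p of order at most q^21, and 6 is the least k with 4 k > 21.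
  -- The constant 1440 κ, with 1440 = 2 * 720, is absorbed by one more factor q.
  1440 * κ * q ^ 21                     <⟨ *-monoˡ-< (q ^ 21) {{m^n≢0 q 21}} κ<q ⟩
  q ^ 22                                ∎)
  where
  open ≤-Reasoning
  instance
    q-nonZero : NonZero q
    q-nonZero = ℕ.>-nonZero (≤-trans (s≤s z≤n) κ<q)
  small : p < h * (2 * (q ^ 3 * q ^ 3)) → q ^ 4 * q ^ 4 * p < h * h * (1 * 1)
  small p<B = begin-strict
    q ^ 4 * q ^ 4 * p                             <⟨ *-monoʳ-< (q ^ 4 * q ^ 4) {{m*n≢0 (q ^ 4) (q ^ 4) {{m^n≢0 q 4}} {{m^n≢0 q 4}}}} p<B ⟩
    q ^ 4 * q ^ 4 * (h * (2 * (q ^ 3 * q ^ 3)))   ≡⟨ e₃ (q ^ 4 * q ^ 4) h (q ^ 3 * q ^ 3) ⟩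
    2 * (q ^ 4 * q ^ 4 * (q ^ 3 * q ^ 3)) * h     ≡⟨ cong (λ t → 2 * t * h) (trans (cong₂ _*_ (sym (^-distribˡ-+-* q 4 4)) (sym (^-distribˡ-+-* q 3 3))) (sym (^-distribˡ-+-* q 8 6))) ⟩
    2 * q ^ 14 * h                                ≤⟨ *-monoˡ-≤ h (≤-trans (*-monoʳ-≤ 2 (^-monoʳ-≤ q (n≤1+n 14))) 2q¹⁵≤h) ⟩
    h * h                                         ≡⟨ *-identityʳ (h * h) ⟨
    h * h * (1 * 1)                               ∎
    where
    e₃ : ∀ s h a → s * (h * (2 * a)) ≡ 2 * (s * a) * h
    e₃ = solve-∀
  e₁ : ∀ h a → 4 * (h * (2 * a) * 720) ≡ 4 * h * (1440 * a)
  e₁ = solve-∀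
  e₂ : ∀ κ x a → κ * x * (1440 * a) ≡ 1440 * κ * (x * a)
  e₂ = solve-∀

-- Small and large subgroups together

card-AA0 : ∀ A → cardH (AA0 A) ≤ length A * length A
card-AA0 A = ≤-trans (length-deduplicate Heis-≟ (cartesianProductWith (λ x y → (x , y , 0)) A A))
  (≤-reflexive (length-cartesianProductWith (λ x y → (x , y , 0)) A A))

AA0-power : ∀ A → cardH (AA0 A) ^ 151 ≤ length A ^ 302
AA0-power A = begin
  cardH (AA0 A) ^ 151           ≤⟨ ^-monoˡ-≤ 151 (card-AA0 A) ⟩
  (length A * length A) ^ 151   ≡⟨ cong (λ t → (length A * t) ^ 151) (*-identityʳ (length A)) ⟨
  (length A ^ 2) ^ 151          ≡⟨ ^-*-assoc (length A) 2 151 ⟩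
  length A ^ 302                ∎
  where open ≤-Reasoning

prodSet-nonZero : ∀ p A → 1 ∈ A → NonZero (cardH (prodSet p (AA0 A) (AA0 A)))
prodSet-nonZero p A 1∈A = nonZero (∈-deduplicate⁺ Heis-≟ (∈-cartesianProductWith⁺ (hmul p) 1∈AA0 1∈AA0))
  where
  1∈AA0 : (1 , 1 , 0) ∈ AA0 A
  1∈AA0 = ∈-deduplicate⁺ Heis-≟ (∈-cartesianProductWith⁺ (λ x y → (x , y , 0)) 1∈A 1∈A)
  nonZero : ∀ {a} {B : Set a} {x : B} {xs} → x ∈ xs → NonZero (length xs)
  nonZero {xs = _ ∷ _} _ = _

IsMultSubgroup-0 : ∀ {A} → ¬ IsMultSubgroup 0 A
IsMultSubgroup-0 subgroup = n≮0 (proj₂ (All.lookup (IsMultSubgroup.inFpStar subgroup) (IsMultSubgroup.hasOne subgroup)))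

-- As q + 1 ≤ 2 q, the upper end of the bracket gives 4 h ≤ 8 (2 q)^15, whence the value 8 * 2^15
-- for κ.
scaled-bracket : ∀ {h q κ} → 8 * 2 ^ 15 ≤ κ → 1 ≤ q → h < 2 * suc q ^ 15 → 4 * h ≤ κ * q ^ 15
scaled-bracket {h} {q} {κ} 2¹⁸≤κ 1≤q h< = begin
  4 * h                       ≤⟨ *-monoʳ-≤ 4 (<⇒≤ h<) ⟩
  4 * (2 * suc q ^ 15)        ≤⟨ *-monoʳ-≤ 4 (*-monoʳ-≤ 2 (^-monoˡ-≤ 15 (+-mono-≤ 1≤q (m≤m+n q 0)))) ⟩
  4 * (2 * (q + (q + 0)) ^ 15) ≡⟨ cong (λ t → 4 * (2 * t)) (^-distribʳ-* 15 2 q) ⟩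
  4 * (2 * (2 ^ 15 * q ^ 15)) ≡⟨ e (2 ^ 15) (q ^ 15) ⟩
  8 * 2 ^ 15 * q ^ 15         ≤⟨ *-monoˡ-≤ (q ^ 15) 2¹⁸≤κ ⟩
  κ * q ^ 15                  ∎
  where
  open ≤-Reasoning
  e : ∀ x y → 4 * (2 * (x * y)) ≡ 8 * x * y
  e = solve-∀

-- The constants stay symbolic, with their values given by equations. The threshold h₀ bounds h as
-- long as q ≤ 1440 κ, and c belongs to the case of larger q.
module _ (κ c h₀ : ℕ) (2¹⁸≤κ : 8 * 2 ^ 15 ≤ κ) (c≡ : c ≡ 1 + (κ * κ + κ * κ * κ)) (h₀≡ : h₀ ≡ 2 * suc (1440 * κ) ^ 15) where
  open ≤-Reasoning

  -- Such an A has at most h₀ elements and its product set is not empty, so the constant alone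
  -- dominates.
  bound-small : ∀ {p A q} → IsMultSubgroup p A → length A < 2 * suc q ^ 15 → q ≤ 1440 * κ →
    length A ^ 302 ≤ (h₀ ^ 302 + c ^ 80) * cardH (prodSet p (AA0 A) (AA0 A)) ^ 80
  bound-small {p} {A} {q} subgroup h< q≤ = begin
    length A ^ 302            ≤⟨ ^-monoˡ-≤ 302 (≤-trans (<⇒≤ h<) (≤-trans (*-monoʳ-≤ 2 (^-monoˡ-≤ 15 (s≤s q≤))) (≤-reflexive (sym h₀≡)))) ⟩
    h₀ ^ 302                  ≤⟨ m≤m+n (h₀ ^ 302) (c ^ 80) ⟩
    h₀ ^ 302 + c ^ 80         ≤⟨ m≤m*n (h₀ ^ 302 + c ^ 80) (cardH (prodSet p (AA0 A) (AA0 A)) ^ 80)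
                                   {{m^n≢0 _ 80 {{prodSet-nonZero p A (IsMultSubgroup.hasOne subgroup)}}}} ⟩
    (h₀ ^ 302 + c ^ 80) * cardH (prodSet p (AA0 A) (AA0 A)) ^ 80 ∎

  bound-large : ∀ {p-1 A q} → Prime (suc p-1) → IsMultSubgroup (suc p-1) A → LeSqrtTimesLn (length A) (suc p-1) →
    2 * q ^ 15 ≤ length A → length A < 2 * suc q ^ 15 → 1440 * κ < q →
    length A ^ 302 ≤ (h₀ ^ 302 + c ^ 80) * cardH (prodSet (suc p-1) (AA0 A) (AA0 A)) ^ 80
  bound-large {p-1} {A} {q} p-prime subgroup hyp ≤h h< <q = begin
    length A ^ 302
      ≤⟨ LargeSubgroup.final-bound p-1 p-prime A subgroup (q ^ 3) (q ^ 5) κ c c≡ (m^n>0 q 3) (m^n>0 q 5)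
           (≤-trans (^-monoʳ-≤ q (n≤1+n 5)) (≤-reflexive (^-distribˡ-+-* q 3 3)))
           (trans (^-+⁵ q 3) (sym (^-+³ q 5)))
           (≤-trans (≤-reflexive (cong (2 *_) (^-+³ q 5))) ≤h)
           (≤-trans 4h≤κq¹⁵ (≤-reflexive (cong (κ *_) (sym (^-+³ q 5)))))
           (large-prime {κ = κ} hyp <q ≤h 4h≤κq¹⁵) ⟩
    c ^ 80 * cardH (prodSet (suc p-1) (AA0 A) (AA0 A)) ^ 80
      ≤⟨ *-monoˡ-≤ (cardH (prodSet (suc p-1) (AA0 A) (AA0 A)) ^ 80) (m≤n+m (c ^ 80) (h₀ ^ 302)) ⟩
    (h₀ ^ 302 + c ^ 80) * cardH (prodSet (suc p-1) (AA0 A) (AA0 A)) ^ 80 ∎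
    where
    1≤q : 1 ≤ q
    1≤q = ≤-trans (s≤s z≤n) <q
    instance
      q-nonZero : NonZero q
      q-nonZero = ℕ.>-nonZero 1≤q
    4h≤κq¹⁵ : 4 * length A ≤ κ * q ^ 15
    4h≤κq¹⁵ = scaled-bracket 2¹⁸≤κ 1≤q h<

  bound : ∀ p → Prime p → ∀ A → IsMultSubgroup p A → LeSqrtTimesLn (length A) p →
    length A ^ 302 ≤ (h₀ ^ 302 + c ^ 80) * cardH (prodSet p (AA0 A) (AA0 A)) ^ 80
  bound zero      _     A subgroup _   = ⊥-elim (IsMultSubgroup-0 subgroup)
  bound (suc p-1) p-prime A subgroup hyp =
    let q , ≤h , h< = power-bracket 2 15 (length A)
    in [ bound-small subgroup h< , bound-large p-prime subgroup hyp ≤h h< ]′ (≤-<-connex q (1440 * κ))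

  growth : Σ[ C ∈ ℕ ] Σ[ C' ∈ ℕ ]
    ((p : ℕ) → Prime p → (A : List ℕ) → IsMultSubgroup p A →
     LeSqrtTimesLn (card A) p →
     cardH (AA0 A) ^ 151
       ≤ C * logF (cardH (prodSet p (AA0 A) (AA0 A))) ^ C'
           * cardH (prodSet p (AA0 A) (AA0 A)) ^ 80)
  -- C adds up the constants of the two cases, and C' = 0 turns the logarithmic factor into 1.
  growth = h₀ ^ 302 + c ^ 80 , 0 , λ p p-prime A subgroup hyp →
    ≤-trans (AA0-power A) (≤-trans (bound p p-prime A subgroup hyp)
      (≤-reflexive (cong (_* cardH (prodSet p (AA0 A) (AA0 A)) ^ 80) (sym (*-identityʳ (h₀ ^ 302 + c ^ 80))))))

theorem1p8 : Σ[ C ∈ ℕ ] Σ[ C' ∈ ℕ ]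
    ((p : ℕ) → Prime p → (A : List ℕ) → IsMultSubgroup p A →
    LeSqrtTimesLn (card A) p →
    cardH (AA0 A) ^ 151
    ≤ C * logF (cardH (prodSet p (AA0 A) (AA0 A))) ^ C'
    * cardH (prodSet p (AA0 A) (AA0 A)) ^ 80)
theorem1p8 = growth κ c h₀ ≤-refl refl refl
  where
  κ c h₀ : ℕ
  κ  = 8 * 2 ^ 15
  c  = 1 + (κ * κ + κ * κ * κ)
  h₀ = 2 * suc (1440 * κ) ^ 15
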